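{- Let $a\ge 0$ be a real number, and let $G$ be a simple connected graph of order $n\ge 2$ with minimum degree $\delta\le\frac{n-1}{2}$. If $$\lambda_{1}(aD(G)+A(G))<\varphi(a,n,\delta,1),$$ then $G$ has a fractional perfect matching.
   Context: Graphs are finite, simple and undirected. $A(G)$ is the adjacency matrix of $G$, $D(G)$ is the diagonal matrix of vertex degrees, and $\lambda_1(M)$ denotes the largest eigenvalue of a real symmetric matrix $M$. A fractional matching of $G$ is a function $f:E(G)\to[0,1]$ such that for every vertex $v$ the sum of $f(e)$ over all edges $e$ incident with $v$ is at most $1$. It is a fractional perfect matching if $\sum_{e\in E(G)}f(e)=n/2$. For real $a\ge 0$, real $k\in(0,n)$ and an integer $\delta\le\frac{n-k}{2}$, define $\varphi(a,n,\delta,k)=\delta\sqrt{1+\frac{2k}{n-k}}$ if $a=0$; $\varphi(a,n,\delta,k)=\frac{2a\delta n}{n-k}$ if $0<a\le 1$; $\varphi(a,n,\delta,k)=\frac{a\delta(n+k)}{n-k}$ if $a>1$. -}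

module Defs where

open import Algebra.Bundles using (CommutativeRing)
open import Algebra.Structures using (IsCommutativeRing)
open import Data.Bool.Base using (Bool; false; T; if_then_else_)
open import Data.Bool.Properties using (T?)
open import Data.Fin.Base as Fin using (Fin)
import Data.Fin.Properties as Fin
open import Data.Fin.Subset using (Subset; ∣_∣)
open import Data.Nat.Base as ℕ using (ℕ)
open import Data.Product.Base using (_×_; _,_; proj₁; proj₂; ∃; ∃-syntax; Σ-syntax)
open import Data.Sum.Base using (_⊎_; inj₁; inj₂)
open import Data.Vec.Base using (tabulate)
open import Data.Vec.Functional using (Vector)
open import Function.Base using (case_of_)
open import Level using (Level; suc)
open import Relation.Binary.Construct.Closure.ReflexiveTransitive using (Star)
import Relation.Binary.Construct.NonStrictToStrict as ToStrict
open import Relation.Binary.PropositionalEquality.Core using (_≡_)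
open import Relation.Binary.Structures using (IsDecTotalOrder)
open import Relation.Nullary using (¬_; Dec; yes; no; does; contradiction)
open import Relation.Nullary.Decidable using (_×-dec_; _⊎-dec_)

-- The classical real numbers, given by the axioms that determine them up to
-- isomorphism.  Decidability of _≈_ and _≤_, and suprema of arbitrary nonempty
-- bounded predicates, are what classical ℝ satisfies; a Bishop-style ℝ is not an
-- instance.  The value of 0# ⁻¹ is left unspecified.

record CompleteOrderedField (ℓ : Level) : Set (suc ℓ) where
  infix  8 _⁻¹ -_
  infixl 7 _*_
  infixl 6 _+_
  infix  4 _≈_ _≤_
  field
    Carrier           : Set ℓ
    _≈_ _≤_           : Carrier → Carrier → Set ℓ
    _+_ _*_           : Carrier → Carrier → Carrier
    -_ _⁻¹            : Carrier → Carrier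
    0# 1#             : Carrier
    isCommutativeRing : IsCommutativeRing _≈_ _+_ _*_ -_ 0# 1#
    0≉1               : ¬ (0# ≈ 1#)
    ⁻¹-cong           : ∀ {x y} → x ≈ y → x ⁻¹ ≈ y ⁻¹
    *-inverseʳ        : ∀ x → ¬ (x ≈ 0#) → x * x ⁻¹ ≈ 1#
    isDecTotalOrder   : IsDecTotalOrder _≈_ _≤_
    +-monoˡ-≤         : ∀ z {x y} → x ≤ y → x + z ≤ y + z
    *-nonNegative     : ∀ {x y} → 0# ≤ x → 0# ≤ y → 0# ≤ x * y

  _IsUpperBoundOf_ : Carrier → (Carrier → Set ℓ) → Set ℓ
  u IsUpperBoundOf P = ∀ x → P x → x ≤ u

  field
    supremum : (P : Carrier → Set ℓ) → ∃ P → (∃[ u ] u IsUpperBoundOf P) →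
               ∃[ s ] s IsUpperBoundOf P × (∀ u → u IsUpperBoundOf P → s ≤ u)

record Graph (n : ℕ) : Set where
  field
    adj        : Fin n → Fin n → Bool
    adj-sym    : ∀ u v → adj u v ≡ adj v u
    adj-irrefl : ∀ v → adj v v ≡ false

module _ {n : ℕ} (G : Graph n) where
  open Graph G

  _~_ : Fin n → Fin n → Set
  u ~ v = T (adj u v)

  Connected : Set
  Connected = ∀ u v → Star _~_ u v

  neighbours : Fin n → Subset n
  neighbours v = tabulate (adj v)

  degree : Fin n → ℕ
  degree v = ∣ neighbours v ∣

  IsMinDegree : ℕ → Set
  IsMinDegree δ = (∃[ v ] degree v ≡ δ) × (∀ v → δ ℕ.≤ degree v)

  -- Each unordered edge {u , v} is represented once, with its smaller endpoint
  -- first.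

  IsEdge : Fin n → Fin n → Set
  IsEdge u v = u Fin.< v × (u ~ v)

  isEdge? : ∀ u v → Dec (IsEdge u v)
  isEdge? u v = (u Fin.<? v) ×-dec T? (adj u v)

  record Edge : Set where
    constructor edge
    field
      lo hi  : Fin n
      isEdge : IsEdge lo hi

  Incident : Fin n → Edge → Set
  Incident v e = (v ≡ Edge.lo e) ⊎ (v ≡ Edge.hi e)

  incident? : ∀ v e → Dec (Incident v e)
  incident? v e = (v Fin.≟ Edge.lo e) ⊎-dec (v Fin.≟ Edge.hi e)

module Real {ℓ : Level} (ℝ : CompleteOrderedField ℓ) where
  open CompleteOrderedField ℝ public

  commutativeRing : CommutativeRing ℓ ℓ
  commutativeRing = record { isCommutativeRing = isCommutativeRing }

  open IsDecTotalOrder isDecTotalOrder public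
    using (_≟_; _≤?_; total; antisym)
    renaming (refl to ≤-refl; trans to ≤-trans; reflexive to ≤-reflexive)
  open ToStrict _≈_ _≤_ public using (_<_)
  open CommutativeRing commutativeRing public
    using (_-_; +-monoid)
  open import Algebra.Properties.Monoid.Sum +-monoid public
    using (sum-syntax)
  open import Algebra.Definitions.RawMonoid
    (CommutativeRing.+-rawMonoid commutativeRing) public
    using () renaming (_×_ to _·_)

  infixl 7 _/_
  _/_ : Carrier → Carrier → Carrier
  x / y = x * y ⁻¹

  fromℕ : ℕ → Carrier
  fromℕ m = m · 1#

  2# : Carrier
  2# = fromℕ 2

  module SquareRoot where
    open CommutativeRing commutativeRing
      using ( commutativeSemiring; refl; sym; trans; setoid; +-cong; +-comm
            ; +-assoc; +-identityˡ; +-identityʳ; -‿inverseˡ; -‿inverseʳ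
            ; *-cong; *-comm; *-assoc; *-identityˡ; *-identityʳ; zeroʳ; distribʳ
            ; distribˡ; +-congˡ; +-congʳ; *-congˡ; *-congʳ; ring)
    open import Algebra.Properties.Ring ring using (-‿distribʳ-*)
    open import Algebra.Solver.Ring.NaturalCoefficients.Default
      commutativeSemiring using (solve; _:+_; _:*_; _:=_; con)
    open import Relation.Binary.Reasoning.Setoid setoid

    expand : ∀ x → x + ((1# + x) + x * x) ≈ (1# + x) * (1# + x)
    expand = solve 1 (λ a → a :+ ((con 1 :+ a) :+ a :* a)
                         := (con 1 :+ a) :* (con 1 :+ a)) refl

    [s+h]² : ∀ s h → s * s + h * ((s + s) + h) ≈ (s + h) * (s + h)
    [s+h]² = solve 2 (λ a b → a :* a :+ b :* ((a :+ a) :+ b)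
                           := (a :+ b) :* (a :+ b)) refl

    2s*h : ∀ s h → (s + s) * h ≈ s * (h + h)
    2s*h = solve 2 (λ a b → (a :+ a) :* b := a :* (b :+ b)) refl

    t²+2[t+h]h : ∀ t h → t * t + ((t + h) + (t + h)) * h
                       ≈ (t + h) * (t + h) + h * h
    t²+2[t+h]h = solve 2 (λ a b → a :* a :+ ((a :+ b) :+ (a :+ b)) :* b
                               := (a :+ b) :* (a :+ b) :+ b :* b) refl

    x*yz : ∀ x y z → x * (y * z) ≈ y * (x * z)
    x*yz = solve 3 (λ a b c → a :* (b :* c) := b :* (a :* c)) refl

    ≤-resp : ∀ {x x′ y y′} → x ≈ x′ → y ≈ y′ → x ≤ y → x′ ≤ y′
    ≤-resp p q x≤y = ≤-trans (≤-reflexive (sym p)) (≤-trans x≤y (≤-reflexive q))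

    +-monoʳ-≤ : ∀ z {x y} → x ≤ y → z + x ≤ z + y
    +-monoʳ-≤ z x≤y = ≤-resp (+-comm _ z) (+-comm _ z) (+-monoˡ-≤ z x≤y)

    -‿+-cancel : ∀ x y → (y - x) + x ≈ y
    -‿+-cancel x y = begin
      (y - x) + x     ≈⟨ +-assoc y (- x) x ⟩
      y + (- x + x)   ≈⟨ +-congˡ (-‿inverseˡ x) ⟩
      y + 0#          ≈⟨ +-identityʳ y ⟩
      y               ∎

    +-‿-cancel : ∀ x y → (y + x) - x ≈ y
    +-‿-cancel x y = begin
      (y + x) - x     ≈⟨ +-assoc y x (- x) ⟩
      y + (x - x)     ≈⟨ +-congˡ (-‿inverseʳ x) ⟩
      y + 0#          ≈⟨ +-identityʳ y ⟩
      y               ∎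

    +-cancelʳ-≤ : ∀ z {x y} → x + z ≤ y + z → x ≤ y
    +-cancelʳ-≤ z p = ≤-resp (+-‿-cancel z _) (+-‿-cancel z _) (+-monoˡ-≤ (- z) p)

    x≤y⇒0≤y-x : ∀ {x y} → x ≤ y → 0# ≤ y - x
    x≤y⇒0≤y-x {x} x≤y = ≤-resp (-‿inverseʳ x) refl (+-monoˡ-≤ (- x) x≤y)

    0≤⇒x≤x+ : ∀ {h} x → 0# ≤ h → x ≤ x + h
    0≤⇒x≤x+ x 0≤h = ≤-resp (+-identityʳ x) refl (+-monoʳ-≤ x 0≤h)

    0≤+ : ∀ {x y} → 0# ≤ x → 0# ≤ y → 0# ≤ x + y
    0≤+ 0≤x 0≤y = ≤-trans 0≤x (0≤⇒x≤x+ _ 0≤y)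

    *-monoˡ-≤ : ∀ {z x y} → 0# ≤ z → x ≤ y → z * x ≤ z * y
    *-monoˡ-≤ {z} {x} {y} 0≤z x≤y =
      ≤-resp refl eq (0≤⇒x≤x+ (z * x) (*-nonNegative 0≤z (x≤y⇒0≤y-x x≤y)))
      where
      eq : z * x + z * (y - x) ≈ z * y
      eq = begin
        z * x + z * (y - x)  ≈⟨ +-comm _ _ ⟩
        z * (y - x) + z * x  ≈⟨ distribˡ z (y - x) x ⟨
        z * ((y - x) + x)    ≈⟨ *-congˡ (-‿+-cancel x y) ⟩
        z * y                ∎

    x≰0⇒0≤x : ∀ {x} → ¬ (x ≤ 0#) → 0# ≤ x
    x≰0⇒0≤x {x} x≰0 with total 0# x
    ... | inj₁ 0≤x = 0≤x
    ... | inj₂ x≤0 = contradiction x≤0 x≰0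

    0≤x² : ∀ x → 0# ≤ x * x
    0≤x² x with total 0# x
    ... | inj₁ 0≤x = *-nonNegative 0≤x 0≤x
    ... | inj₂ x≤0 = ≤-resp refl eq (*-nonNegative 0≤-x 0≤-x)
      where
      0≤-x : 0# ≤ - x
      0≤-x = ≤-resp refl (+-identityˡ (- x)) (x≤y⇒0≤y-x x≤0)
      open import Algebra.Properties.Ring ring using (-‿distribˡ-*; -‿involutive)
      eq : (- x) * (- x) ≈ x * x
      eq = begin
        (- x) * (- x)    ≈⟨ -‿distribˡ-* x (- x) ⟨
        - (x * (- x))    ≈⟨ -‿cong (-‿distribʳ-* x x) ⟨
        - (- (x * x))    ≈⟨ -‿involutive (x * x) ⟩
        x * x            ∎
        where open CommutativeRing commutativeRing using (-‿cong)

    0≤1 : 0# ≤ 1#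
    0≤1 = ≤-resp refl (*-identityˡ 1#) (0≤x² 1#)

    1≰0 : ¬ (1# ≤ 0#)
    1≰0 1≤0 = 0≉1 (antisym 0≤1 1≤0)

    0≤x⁻¹ : ∀ {x} → 0# ≤ x → ¬ (x ≈ 0#) → 0# ≤ x ⁻¹
    0≤x⁻¹ {x} 0≤x x≉0 = x≰0⇒0≤x λ x⁻¹≤0 →
      1≰0 (≤-resp (*-inverseʳ x x≉0) (zeroʳ x) (*-monoˡ-≤ 0≤x x⁻¹≤0))

    *-cancelˡ-≤ : ∀ {z x y} → 0# ≤ z → ¬ (z ≈ 0#) → z * x ≤ z * y → x ≤ y
    *-cancelˡ-≤ {z} 0≤z z≉0 p =
      ≤-resp (eq _) (eq _) (*-monoˡ-≤ (0≤x⁻¹ 0≤z z≉0) p)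
      where
      eq : ∀ w → z ⁻¹ * (z * w) ≈ w
      eq w = begin
        z ⁻¹ * (z * w)  ≈⟨ *-assoc _ z w ⟨
        (z ⁻¹ * z) * w  ≈⟨ *-congʳ (*-comm _ z) ⟩
        (z * z ⁻¹) * w  ≈⟨ *-congʳ (*-inverseʳ z z≉0) ⟩
        1# * w          ≈⟨ *-identityˡ w ⟩
        w               ∎

    *-/-cancel : ∀ {m} d → ¬ (m ≈ 0#) → m * (d / m) ≈ d
    *-/-cancel {m} d m≉0 = begin
      m * (d * m ⁻¹)  ≈⟨ x*yz m d (m ⁻¹) ⟩
      d * (m * m ⁻¹)  ≈⟨ *-congˡ (*-inverseʳ m m≉0) ⟩
      d * 1#          ≈⟨ *-identityʳ d ⟩
      d               ∎

    square-cancel-≤ : ∀ {y t} → 0# ≤ t → y * y ≤ t * t → y ≤ t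
    square-cancel-≤ {y} {t} 0≤t y²≤t² with y ≤? t
    ... | yes y≤t = y≤t
    ... | no  y≰t with total y t
    ...   | inj₁ y≤t = y≤t
    ...   | inj₂ t≤y = *-cancelˡ-≤ 0≤y y≉0
      (≤-trans y²≤t² (≤-resp refl (*-comm t y) (*-monoˡ-≤ 0≤t t≤y)))
      where
      0≤y : 0# ≤ y
      0≤y = ≤-trans 0≤t t≤y
      y≉0 : ¬ (y ≈ 0#)
      y≉0 y≈0 = y≰t (≤-resp (sym y≈0) refl 0≤t)

    module _ {x : Carrier} (0≤x : 0# ≤ x) where

      private
        P : Carrier → Set ℓ
        P y = y * y ≤ x

        P0 : P 0#
        P0 = ≤-resp (sym (zeroʳ 0#)) refl 0≤x

        bounded : (1# + x) IsUpperBoundOf P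
        bounded y y²≤x = square-cancel-≤ (0≤+ 0≤1 0≤x)
          (≤-trans y²≤x (≤-resp refl (expand x)
            (0≤⇒x≤x+ x (0≤+ (0≤+ 0≤1 0≤x) (0≤x² x)))))

      module Supremum (s : Carrier) (s-upper : s IsUpperBoundOf P)
                      (s-least : ∀ u → u IsUpperBoundOf P → s ≤ u) where

        0≤s : 0# ≤ s
        0≤s = s-upper 0# P0

        -- If s² ≤ x, then s + d / (2s + 1 + d) also has square at most x,
        -- where d = x - s²; hence d ≤ 0.
        below : s * s ≤ x → s * s ≈ x
        below s²≤x with s * s ≟ x
        ... | yes s²≈x = s²≈x
        ... | no  s²≉x = contradiction d≈0 d≉0
          where
          d r m h : Carrier
          d = x - s * s
          r = (s + s) + 1#
          m = r + d
          h = d / m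
          0≤d : 0# ≤ d
          0≤d = x≤y⇒0≤y-x s²≤x
          s²+d≈x : s * s + d ≈ x
          s²+d≈x = trans (+-comm _ _) (-‿+-cancel (s * s) x)
          d≉0 : ¬ (d ≈ 0#)
          d≉0 d≈0 = s²≉x (trans (sym (+-identityʳ _))
                           (trans (+-congˡ (sym d≈0)) s²+d≈x))
          0≤r : 0# ≤ r
          0≤r = 0≤+ (0≤+ 0≤s 0≤s) 0≤1
          1≤m : 1# ≤ m
          1≤m = ≤-trans (≤-resp refl (+-comm 1# _) (0≤⇒x≤x+ 1# (0≤+ 0≤s 0≤s)))
                        (0≤⇒x≤x+ r 0≤d)
          0≤m : 0# ≤ m
          0≤m = ≤-trans 0≤1 1≤m
          m≉0 : ¬ (m ≈ 0#)
          m≉0 m≈0 = 1≰0 (≤-resp refl m≈0 1≤m)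
          mh≈d : m * h ≈ d
          mh≈d = *-/-cancel d m≉0
          0≤h : 0# ≤ h
          0≤h = *-nonNegative 0≤d (0≤x⁻¹ 0≤m m≉0)
          h≤1 : h ≤ 1#
          h≤1 = *-cancelˡ-≤ 0≤m m≉0
            (≤-resp (sym mh≈d) (trans (+-comm d r) (sym (*-identityʳ m)))
              (0≤⇒x≤x+ d 0≤r))
          hr≤d : h * r ≤ d
          hr≤d = ≤-resp refl
            (trans (sym (distribˡ h r d)) (trans (*-comm h m) mh≈d))
            (0≤⇒x≤x+ (h * r) (*-nonNegative 0≤h 0≤d))
          P[s+h] : P (s + h)
          P[s+h] = ≤-resp
            ([s+h]² s h)
            s²+d≈x
            (+-monoʳ-≤ (s * s)
              (≤-trans (*-monoˡ-≤ 0≤h (+-monoʳ-≤ (s + s) h≤1)) hr≤d))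
          h≤0 : h ≤ 0#
          h≤0 = +-cancelʳ-≤ s
            (≤-resp (+-comm s h) (sym (+-identityˡ s)) (s-upper (s + h) P[s+h]))
          d≈0 : d ≈ 0#
          d≈0 = trans (sym mh≈d) (trans (*-congˡ (antisym h≤0 0≤h)) (zeroʳ m))

        -- If x ≤ s², then t = s - (s² - x) / 2s is an upper bound, so s ≤ t.
        above : x ≤ s * s → s * s ≈ x
        above x≤s² with s * s ≟ x
        ... | yes s²≈x = s²≈x
        ... | no  s²≉x = contradiction e≈0 e≉0
          where
          e h t : Carrier
          e = s * s - x
          h = e / (s + s)
          t = s - h
          0≤e : 0# ≤ e
          0≤e = x≤y⇒0≤y-x x≤s²
          e+x≈s² : e + x ≈ s * s
          e+x≈s² = -‿+-cancel x (s * s)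
          e≉0 : ¬ (e ≈ 0#)
          e≉0 e≈0 = s²≉x (trans (sym e+x≈s²)
                           (trans (+-congʳ e≈0) (+-identityˡ x)))
          s≉0 : ¬ (s ≈ 0#)
          s≉0 s≈0 = s²≉x (antisym
            (≤-resp (sym (trans (*-congˡ s≈0) (zeroʳ s))) refl 0≤x) x≤s²)
          0≤2s : 0# ≤ s + s
          0≤2s = 0≤+ 0≤s 0≤s
          2s≉0 : ¬ (s + s ≈ 0#)
          2s≉0 2s≈0 = s≉0 (antisym (≤-resp refl 2s≈0 (0≤⇒x≤x+ s 0≤s)) 0≤s)
          2sh≈e : (s + s) * h ≈ e
          2sh≈e = *-/-cancel e 2s≉0
          0≤h : 0# ≤ h
          0≤h = *-nonNegative 0≤e (0≤x⁻¹ 0≤2s 2s≉0)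
          2h≤s : h + h ≤ s
          2h≤s = *-cancelˡ-≤ 0≤s s≉0 (≤-resp
            (trans (sym 2sh≈e)
              (2s*h s h))
            e+x≈s²
            (0≤⇒x≤x+ e 0≤x))
          0≤t : 0# ≤ t
          0≤t = x≤y⇒0≤y-x (≤-trans (0≤⇒x≤x+ h 0≤h) 2h≤s)
          t+h≈s : t + h ≈ s
          t+h≈s = -‿+-cancel h s
          t²+e≈s²+h² : t * t + e ≈ s * s + h * h
          t²+e≈s²+h² = begin
            t * t + e
              ≈⟨ +-congˡ 2sh≈e ⟨
            t * t + (s + s) * h
              ≈⟨ +-congˡ (*-congʳ (+-cong t+h≈s t+h≈s)) ⟨
            t * t + ((t + h) + (t + h)) * h
              ≈⟨ t²+2[t+h]h t h ⟩
            (t + h) * (t + h) + h * h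
              ≈⟨ +-congʳ (*-cong t+h≈s t+h≈s) ⟩
            s * s + h * h ∎
          x≤t² : x ≤ t * t
          x≤t² = +-cancelʳ-≤ e (≤-resp
            (trans (sym e+x≈s²) (+-comm e x)) (sym t²+e≈s²+h²)
            (0≤⇒x≤x+ (s * s) (0≤x² h)))
          s≤t : s ≤ t
          s≤t = s-least t λ y y²≤x → square-cancel-≤ 0≤t (≤-trans y²≤x x≤t²)
          h≤0 : h ≤ 0#
          h≤0 = +-cancelʳ-≤ t (≤-resp
            (trans (sym t+h≈s) (+-comm t h)) (sym (+-identityˡ t)) s≤t)
          e≈0 : e ≈ 0#
          e≈0 = trans (sym 2sh≈e)
                  (trans (*-congˡ (antisym h≤0 0≤h)) (zeroʳ (s + s)))

      √-exists : ∃[ r ] 0# ≤ r × r * r ≈ x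
      √-exists =
        let s , s-upper , s-least = supremum P (0# , P0) (1# + x , bounded)
            open Supremum s s-upper s-least
        in s , 0≤s , (case total (s * s) x of λ where
             (inj₁ s²≤x) → below s²≤x
             (inj₂ x≤s²) → above x≤s²)

  -- The nonnegative square root, with the junk value 0 on negative numbers.
  √ : Carrier → Carrier
  √ x with 0# ≤? x
  ... | yes 0≤x = proj₁ (SquareRoot.√-exists 0≤x)
  ... | no  _   = 0#

  √-nonNegative : ∀ {x} → 0# ≤ x → 0# ≤ √ x
  √-nonNegative {x} 0≤x with 0# ≤? x
  ... | yes p = proj₁ (proj₂ (SquareRoot.√-exists p))
  ... | no ¬p = contradiction 0≤x ¬p

  √-square : ∀ {x} → 0# ≤ x → √ x * √ x ≈ x
  √-square {x} 0≤x with 0# ≤? x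
  ... | yes p = proj₂ (proj₂ (SquareRoot.√-exists p))
  ... | no ¬p = contradiction 0≤x ¬p

  Matrix : ℕ → Set ℓ
  Matrix n = Fin n → Fin n → Carrier

  IsEigenvalue : ∀ {n} → Matrix n → Carrier → Set ℓ
  IsEigenvalue {n} M μ = Σ[ x ∈ Vector Carrier n ] ¬ (∀ i → x i ≈ 0#)
    × (∀ i → ∑[ j < n ] (M i j * x j) ≈ μ * x i)

  IsLargestEigenvalue : ∀ {n} → Matrix n → Carrier → Set ℓ
  IsLargestEigenvalue M μ =
    IsEigenvalue M μ × (∀ ν → IsEigenvalue M ν → ν ≤ μ)

  module _ {n : ℕ} (G : Graph n) where
    open Graph G

    adjacencyMatrix : Matrix n
    adjacencyMatrix u v = if adj u v then 1# else 0#

    degreeMatrix : Matrix n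
    degreeMatrix u v = if does (u Fin.≟ v) then fromℕ (degree G u) else 0#

    aD+A : Carrier → Matrix n
    aD+A a u v = a * degreeMatrix u v + adjacencyMatrix u v

    edgeSum : (Edge G → Carrier) → Carrier
    edgeSum f = ∑[ u < n ] ∑[ v < n ] term u v (isEdge? G u v)
      where
      term : ∀ u v → Dec (IsEdge G u v) → Carrier
      term u v (yes p) = f (edge u v p)
      term u v (no  _) = 0#

    incidentSum : (Edge G → Carrier) → Fin n → Carrier
    incidentSum f v = edgeSum λ e → if does (incident? G v e) then f e else 0#

    IsFractionalMatching : (Edge G → Carrier) → Set ℓ
    IsFractionalMatching f =
      (∀ e → 0# ≤ f e × f e ≤ 1#) × (∀ v → incidentSum f v ≤ 1#)

    IsFractionalPerfectMatching : (Edge G → Carrier) → Set ℓ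
    IsFractionalPerfectMatching f =
      IsFractionalMatching f × edgeSum f ≈ fromℕ n / 2#

    HasFractionalPerfectMatching : Set ℓ
    HasFractionalPerfectMatching = ∃[ f ] IsFractionalPerfectMatching f

  -- φ a n δ k is meaningful for 0 ≤ a, 0 < k < n and δ ≤ (n - k) / 2; outside
  -- this range its value is junk.
  φ : (a n δ k : Carrier) → Carrier
  φ a n δ k with a ≟ 0# | a ≤? 1#
  ... | yes _ | _     = δ * √ (1# + (2# * k) / (n - k))
  ... | no  _ | yes _ = (2# * a * δ * n) / (n - k)
  ... | no  _ | no  _ = (a * δ * (n + k)) / (n - k)

{-# OPTIONS --safe #-}
module Submission where

-- Without a fractional perfect matching the neighbourhood system violates
-- Hall's condition at some vertex set X, since a system of distinct
-- representatives is a permutation σ with v ~ σ v, and weight ½ on every edge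
-- {v , σ v} gives a perfect matching.  Then I = X \ N(X) is independent, its
-- neighbours lie in S = N(X) \ X, and ∣S∣ < ∣I∣.  At least δ ∣I∣ edges join I to
-- S, so a vector constant on I and on S and zero elsewhere has Rayleigh
-- quotient at least φ.  The Rayleigh quotient is bounded by the largest
-- eigenvalue because its supremum μ is an eigenvalue: by elimination, the
-- positive semidefinite matrix μ I - M is either singular or bounded below by
-- a positive multiple of the identity, and the latter contradicts the choice
-- of μ.

open import Defs
open import Algebra.Bundles using (CommutativeRing)
open import Data.Bool.Base using (true; false; Bool; T; if_then_else_; _∨_)
open import Data.Bool.Properties using (T-≡)
open import Data.Fin.Base using (Fin; zero; suc)
open import Data.Fin.Properties using (any?; _≟_; _<?_; <-cmp)
open import Data.Fin.Subset hiding (_-_)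
open import Data.Fin.Subset.Properties
open import Data.Nat.Base using (ℕ; z≤n; s≤s)
import Data.Nat.Base as ℕ
open import Data.Nat.Induction using (<-wellFounded)
import Data.Nat.Properties as ℕ
open import Data.Product.Base using (_×_; _,_; proj₁; proj₂; ∃-syntax; Σ-syntax)
open import Data.Sum.Base as Sum using (_⊎_; inj₁; inj₂)
open import Data.Vec.Base using ([]; _∷_; tabulate; lookup)
open import Data.Vec.Functional using (Vector) renaming (_∷_ to _∷ᶠ_)
open import Data.Vec.Properties using (lookup∘tabulate; lookup⇒[]=; []=⇒lookup)
open import Function.Base using (_∘_)
open import Function.Bundles using (Equivalence)
open import Function.Definitions using (Injective)
open import Induction.WellFounded using (Acc; acc)
open import Relation.Binary.Bundles using (Poset)
open import Relation.Binary.Construct.Closure.ReflexiveTransitive using (_◅_)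
open import Relation.Binary.Definitions using (tri<; tri≈; tri>)
open import Relation.Binary.PropositionalEquality as ≡ using (_≡_; _≢_)
open import Relation.Binary.Structures using (IsDecTotalOrder)
open import Relation.Nullary using (¬_; Dec; yes; no; does; contradiction)
open import Relation.Nullary.Decidable using (_×-dec_; ¬?; dec-true; dec-false)

open import Algebra.Definitions.RawMonoid ℕ.+-0-rawMonoid using () renaming (sum to sumℕ)

-- The constants come from the extremal shape of a barrier. From ∣S∣ < ∣I∣ and ∣I∣ + ∣S∣ ≤ n follows
-- ∣I∣ / ∣S∣ ≥ ρ = (n + 1) / (n - 1), and in terms of ρ the three branches of `φ` at k = 1 read δ
-- √ρ, a δ (1 + ρ) and a δ ρ. If every vertex of `I` had degree δ and every vertex of `S` had degree
-- ρ δ with all its neighbours in `I`, the vector with 1 on `I` and p on `S` would be an eigenvector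
-- for p = √ρ at a = 0 and for p = ρ at a = 1; the test vectors are these. For a > 1 the diagonal
-- entries on `S` alone suffice. The spectral obstacle is that `IsLargestEigenvalue` compares λ₁
-- only with other eigenvalues, so a large Rayleigh quotient says nothing until an eigenvalue at
-- least as large is exhibited. Order completeness yields the supremum of the quotients but no
-- vector attaining it. Elimination closes this gap: since equality is decidable, it computes either
-- a null vector or an explicit coercivity constant.

private variable m n : ℕ

-- Cardinalities of finite subsets

∣p∪q∣+∣p∩q∣≡∣p∣+∣q∣ : ∀ (p q : Subset n) → ∣ p ∪ q ∣ ℕ.+ ∣ p ∩ q ∣ ≡ ∣ p ∣ ℕ.+ ∣ q ∣
∣p∪q∣+∣p∩q∣≡∣p∣+∣q∣ [] [] = ≡.refl
∣p∪q∣+∣p∩q∣≡∣p∣+∣q∣ (outside ∷ p) (outside ∷ q) = ∣p∪q∣+∣p∩q∣≡∣p∣+∣q∣ p q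
∣p∪q∣+∣p∩q∣≡∣p∣+∣q∣ (outside ∷ p) (inside  ∷ q) =
  ≡.trans (≡.cong ℕ.suc (∣p∪q∣+∣p∩q∣≡∣p∣+∣q∣ p q)) (≡.sym (ℕ.+-suc ∣ p ∣ ∣ q ∣))
∣p∪q∣+∣p∩q∣≡∣p∣+∣q∣ (inside  ∷ p) (outside ∷ q) = ≡.cong ℕ.suc (∣p∪q∣+∣p∩q∣≡∣p∣+∣q∣ p q)
∣p∪q∣+∣p∩q∣≡∣p∣+∣q∣ (inside  ∷ p) (inside  ∷ q) = ≡.cong ℕ.suc
  (≡.trans (ℕ.+-suc _ _) (≡.trans (≡.cong ℕ.suc (∣p∪q∣+∣p∩q∣≡∣p∣+∣q∣ p q))
    (≡.sym (ℕ.+-suc ∣ p ∣ ∣ q ∣))))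

∣p∣≤∣p─q∣+∣q∣ : ∀ (p q : Subset n) → ∣ p ∣ ℕ.≤ ∣ p ─ q ∣ ℕ.+ ∣ q ∣
∣p∣≤∣p─q∣+∣q∣ [] [] = z≤n
∣p∣≤∣p─q∣+∣q∣ (outside ∷ p) (outside ∷ q) = ∣p∣≤∣p─q∣+∣q∣ p q
∣p∣≤∣p─q∣+∣q∣ (outside ∷ p) (inside  ∷ q) =
  ℕ.≤-trans (∣p∣≤∣p─q∣+∣q∣ p q) (ℕ.+-monoʳ-≤ ∣ p ─ q ∣ (ℕ.n≤1+n ∣ q ∣))
∣p∣≤∣p─q∣+∣q∣ (inside  ∷ p) (outside ∷ q) = s≤s (∣p∣≤∣p─q∣+∣q∣ p q)
∣p∣≤∣p─q∣+∣q∣ (inside  ∷ p) (inside  ∷ q) =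
  ℕ.≤-trans (s≤s (∣p∣≤∣p─q∣+∣q∣ p q)) (ℕ.≤-reflexive (≡.sym (ℕ.+-suc ∣ p ─ q ∣ ∣ q ∣)))

0<∣p∣⇒Nonempty : ∀ (p : Subset n) → 0 ℕ.< ∣ p ∣ → Nonempty p
0<∣p∣⇒Nonempty {n} p 0<∣p∣ with nonempty? p
... | yes nonempty = nonempty
... | no  empty = contradiction (≡.trans (≡.cong ∣_∣ (Empty-unique empty)) (∣⊥∣≡0 n)) (ℕ.>⇒≢ 0<∣p∣)

sumℕ-mono-≤ : ∀ {f g : Fin n → ℕ} → (∀ i → f i ℕ.≤ g i) → sumℕ f ℕ.≤ sumℕ g
sumℕ-mono-≤ {ℕ.zero}  f≤g = z≤n
sumℕ-mono-≤ {ℕ.suc n} f≤g = ℕ.+-mono-≤ (f≤g zero) (sumℕ-mono-≤ (f≤g ∘ suc))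

sumℕ-mono-< : ∀ {f g : Fin n → ℕ} → (∀ i → f i ℕ.≤ g i) → ∀ k → f k ℕ.< g k → sumℕ f ℕ.< sumℕ g
sumℕ-mono-< f≤g zero    fk<gk = ℕ.+-mono-<-≤ fk<gk (sumℕ-mono-≤ (f≤g ∘ suc))
sumℕ-mono-< f≤g (suc k) fk<gk = ℕ.+-mono-≤-< (f≤g zero) (sumℕ-mono-< (f≤g ∘ suc) k fk<gk)

-- Hall's theorem by edge deletion

module _ (N : Fin m → Subset n) where

  image : Subset m → Subset n
  image X = tabulate λ y → does (any? λ v → (v ∈? X) ×-dec (y ∈? N v))

  ∈-image⁺ : ∀ {X v y} → v ∈ X → y ∈ N v → y ∈ image X
  ∈-image⁺ {X} {v} {y} v∈X y∈Nv = lookup⇒[]= y _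
    (≡.trans (lookup∘tabulate _ y) (dec-true (any? _) (v , v∈X , y∈Nv)))

  ∈-image⁻ : ∀ {X y} → y ∈ image X → ∃[ v ] v ∈ X × y ∈ N v
  ∈-image⁻ {X} {y} y∈image
    -- The decision is abstracted together with the Boolean equation that contains it, so the `no`
    -- case would carry `false ≡ true` and needs no clause.
    with any? (λ v → (v ∈? X) ×-dec (y ∈? N v))
       | ≡.trans (≡.sym (lookup∘tabulate _ y)) ([]=⇒lookup y∈image)
  ... | yes p | _ = p

  Hall : Set
  Hall = ∀ X → ∣ X ∣ ℕ.≤ ∣ image X ∣

  Violator : Set
  Violator = ∃[ X ] ∣ image X ∣ ℕ.< ∣ X ∣

  hall? : Hall ⊎ Violator
  hall? with anySubset? (λ X → ∣ image X ∣ ℕ.<? ∣ X ∣)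
  ... | yes violator = inj₂ violator
  ... | no  none     = inj₁ λ X → ℕ.≮⇒≥ λ lt → none (X , lt)

  remove : Fin m → Fin n → Fin m → Subset n
  remove v y w with w ≟ v
  ... | yes _ = N w ─ ⁅ y ⁆
  ... | no  _ = N w

  remove-⊆ : ∀ v y w → remove v y w ⊆ N w
  remove-⊆ v y w with w ≟ v
  ... | yes _ = p─q⊆p (N w) ⁅ y ⁆
  ... | no  _ = λ z∈ → z∈

  ∈-remove-≢ˡ : ∀ v y {w z} → w ≢ v → z ∈ N w → z ∈ remove v y w
  ∈-remove-≢ˡ v y {w} w≢v z∈ with w ≟ v
  ... | yes w≡v = contradiction w≡v w≢v
  ... | no  _   = z∈

  ∈-remove-≢ʳ : ∀ v y {w z} → z ≢ y → z ∈ N w → z ∈ remove v y w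
  ∈-remove-≢ʳ v y {w} z≢y z∈ with w ≟ v
  ... | yes _ = x∈p∧x≢y⇒x∈p-y z∈ z≢y
  ... | no  _ = z∈

  remove-< : ∀ {v y} → y ∈ N v → ∣ remove v y v ∣ ℕ.< ∣ N v ∣
  remove-< {v} y∈ with v ≟ v
  ... | yes _   = x∈p⇒∣p-x∣<∣p∣ y∈
  ... | no  v≢v = contradiction ≡.refl v≢v

-- Deleting an edge at `v` does not change the neighbourhood of a set avoiding `v`, so such a set
-- still satisfies the original Hall condition.
∈-violator-remove : ∀ (N : Fin m → Subset n) v y X → Hall N →
                    ∣ image (remove N v y) X ∣ ℕ.< ∣ X ∣ → v ∈ X
∈-violator-remove N v y X hall lt with v ∈? X
... | yes v∈X = v∈X
... | no  v∉X = contradiction (hall X) (ℕ.<⇒≱ (ℕ.≤-<-trans (p⊆q⇒∣p∣≤∣q∣ image⊆) lt))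
  where
  image⊆ : image N X ⊆ image (remove N v y) X
  image⊆ z∈ with w , w∈X , z∈Nw ← ∈-image⁻ N z∈ =
    ∈-image⁺ (remove N v y) w∈X (∈-remove-≢ˡ N v y (λ { ≡.refl → v∉X w∈X }) z∈Nw)

-- Rado: if neither edge could be deleted, the modular law applied to the two
-- violators would contradict Hall's condition on their union and their
-- intersection without v.
remove-preserves-Hall : ∀ (N : Fin m → Subset n) {v y₁ y₂} → y₁ ≢ y₂ → Hall N →
                        Hall (remove N v y₁) ⊎ Hall (remove N v y₂)
remove-preserves-Hall N {v} {y₁} {y₂} y₁≢y₂ hall
  with hall? (remove N v y₁) | hall? (remove N v y₂)
... | inj₁ hall₁ | _ = inj₁ hall₁
... | inj₂ _ | inj₁ hall₂ = inj₂ hall₂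
... | inj₂ (X₁ , lt₁) | inj₂ (X₂ , lt₂) = contradiction too-small (ℕ.n≮n _)
  where
  N₁ = remove N v y₁
  N₂ = remove N v y₂
  A₁ = image N₁ X₁
  A₂ = image N₂ X₂

  v∈X₁ : v ∈ X₁
  v∈X₁ = ∈-violator-remove N v y₁ X₁ hall lt₁
  v∈X₂ : v ∈ X₂
  v∈X₂ = ∈-violator-remove N v y₂ X₂ hall lt₂

  -- The union loses nothing: `y₁` is deleted from `N v` only in `N₁` and is still reached from `v`
  -- in `N₂`.
  ∪⊆ : image N (X₁ ∪ X₂) ⊆ A₁ ∪ A₂
  ∪⊆ {z} z∈ with w , w∈ , z∈Nw ← ∈-image⁻ N z∈ with w ≟ v | z ≟ y₁
  ... | yes ≡.refl | no z≢y₁ = x∈p∪q⁺ (inj₁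
    (∈-image⁺ N₁ v∈X₁ (∈-remove-≢ʳ N v y₁ z≢y₁ z∈Nw)))
  ... | yes ≡.refl | yes ≡.refl = x∈p∪q⁺ (inj₂
    (∈-image⁺ N₂ v∈X₂ (∈-remove-≢ʳ N v y₂ y₁≢y₂ z∈Nw)))
  ... | no w≢v | _ with x∈p∪q⁻ X₁ X₂ w∈
  ...   | inj₁ w∈X₁ = x∈p∪q⁺ (inj₁ (∈-image⁺ N₁ w∈X₁ (∈-remove-≢ˡ N v y₁ w≢v z∈Nw)))
  ...   | inj₂ w∈X₂ = x∈p∪q⁺ (inj₂ (∈-image⁺ N₂ w∈X₂ (∈-remove-≢ˡ N v y₂ w≢v z∈Nw)))

  ∩⊆ : image N (X₁ ∩ X₂ ─ ⁅ v ⁆) ⊆ A₁ ∩ A₂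
  ∩⊆ {z} z∈ with w , w∈ , z∈Nw ← ∈-image⁻ N z∈ =
    x∈p∩q⁺ ( ∈-image⁺ N₁ (proj₁ w∈X₁×w∈X₂) (∈-remove-≢ˡ N v y₁ w≢v z∈Nw)
           , ∈-image⁺ N₂ (proj₂ w∈X₁×w∈X₂) (∈-remove-≢ˡ N v y₂ w≢v z∈Nw))
    where
    w∈X₁×w∈X₂ = x∈p∩q⁻ X₁ X₂ (p─q⊆p (X₁ ∩ X₂) ⁅ v ⁆ w∈)
    -- If `w` were `v`, deleting `v` a second time would shrink a set on which the deletion is
    -- idempotent.
    w≢v : w ≢ v
    w≢v ≡.refl = ℕ.<-irrefl ≡.refl
      (ℕ.<-≤-trans (x∈p⇒∣p-x∣<∣p∣ w∈)
        (ℕ.≤-reflexive (≡.cong ∣_∣ (≡.sym (p─q─q≡p─q (X₁ ∩ X₂) ⁅ v ⁆)))))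

  open ℕ.≤-Reasoning
  -- Leaving `v` out of the intersection costs one, while the two strict inequalities together gain
  -- two.
  too-small : ∣ X₁ ∣ ℕ.+ ∣ X₂ ∣ ℕ.< ∣ X₁ ∣ ℕ.+ ∣ X₂ ∣
  too-small = begin-strict
    ∣ X₁ ∣ ℕ.+ ∣ X₂ ∣
      ≡⟨ ∣p∪q∣+∣p∩q∣≡∣p∣+∣q∣ X₁ X₂ ⟨
    ∣ X₁ ∪ X₂ ∣ ℕ.+ ∣ X₁ ∩ X₂ ∣
      ≤⟨ ℕ.+-monoʳ-≤ ∣ X₁ ∪ X₂ ∣ (∣p∣≤∣p─q∣+∣q∣ (X₁ ∩ X₂) ⁅ v ⁆) ⟩
    ∣ X₁ ∪ X₂ ∣ ℕ.+ (∣ X₁ ∩ X₂ ─ ⁅ v ⁆ ∣ ℕ.+ ∣ ⁅ v ⁆ ∣)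
      ≤⟨ ℕ.+-mono-≤ (ℕ.≤-trans (hall _) (p⊆q⇒∣p∣≤∣q∣ ∪⊆))
          (ℕ.+-mono-≤ (ℕ.≤-trans (hall _) (p⊆q⇒∣p∣≤∣q∣ ∩⊆)) (ℕ.≤-reflexive (∣⁅x⁆∣≡1 v))) ⟩
    ∣ A₁ ∪ A₂ ∣ ℕ.+ (∣ A₁ ∩ A₂ ∣ ℕ.+ 1)
      ≡⟨ ℕ.+-assoc ∣ A₁ ∪ A₂ ∣ _ 1 ⟨
    ∣ A₁ ∪ A₂ ∣ ℕ.+ ∣ A₁ ∩ A₂ ∣ ℕ.+ 1
      ≡⟨ ≡.cong (ℕ._+ 1) (∣p∪q∣+∣p∩q∣≡∣p∣+∣q∣ A₁ A₂) ⟩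
    ∣ A₁ ∣ ℕ.+ ∣ A₂ ∣ ℕ.+ 1
      ≡⟨ ℕ.+-comm _ 1 ⟩
    ℕ.suc ∣ A₁ ∣ ℕ.+ ∣ A₂ ∣
      <⟨ ℕ.+-mono-≤-< lt₁ lt₂ ⟩
    ∣ X₁ ∣ ℕ.+ ∣ X₂ ∣
      ∎

SystemOfRepresentatives : (Fin m → Subset n) → Set
SystemOfRepresentatives N = ∃[ σ ] Injective _≡_ _≡_ σ × (∀ v → σ v ∈ N v)

Subsingletons : (Fin m → Subset n) → Set
Subsingletons N = ∀ v {y₁ y₂} → y₁ ∈ N v → y₂ ∈ N v → y₁ ≡ y₂

-- Two vertices sharing a representative would form a two-element set whose only neighbour is that
-- representative.
section-injective : ∀ (N : Fin m → Subset n) → Hall N → Subsingletons N →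
                    ∀ σ → (∀ v → σ v ∈ N v) → Injective _≡_ _≡_ σ
section-injective N hall unique σ σ∈N {u} {v} σu≡σv with u ≟ v
... | yes u≡v = u≡v
... | no  u≢v = contradiction (hall X) (ℕ.<⇒≱ ∣image∣<∣X∣)
  where
  X = ⁅ u ⁆ ∪ ⁅ v ⁆

  N⊆ : ∀ {w y} → w ∈ X → y ∈ N w → y ≡ σ u
  N⊆ w∈ y∈Nw with x∈p∪q⁻ ⁅ u ⁆ ⁅ v ⁆ w∈
  ... | inj₁ w∈u rewrite x∈⁅y⁆⇒x≡y u w∈u = unique u y∈Nw (σ∈N u)
  ... | inj₂ w∈v rewrite x∈⁅y⁆⇒x≡y v w∈v = ≡.trans (unique v y∈Nw (σ∈N v)) (≡.sym σu≡σv)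

  image⊆ : image N X ⊆ ⁅ σ u ⁆
  image⊆ y∈ with w , w∈ , y∈Nw ← ∈-image⁻ N y∈ =
    ≡.subst (_∈ ⁅ σ u ⁆) (≡.sym (N⊆ w∈ y∈Nw)) (x∈⁅x⁆ (σ u))

  ∣image∣<∣X∣ : ∣ image N X ∣ ℕ.< ∣ X ∣
  ∣image∣<∣X∣ = ℕ.≤-<-trans
    (ℕ.≤-trans (p⊆q⇒∣p∣≤∣q∣ image⊆)
      (ℕ.≤-reflexive (≡.trans (∣⁅x⁆∣≡1 (σ u)) (≡.sym (∣⁅x⁆∣≡1 u)))))
    (p⊂q⇒∣p∣<∣q∣ ( p⊆p∪q {p = ⁅ u ⁆} ⁅ v ⁆
                 , v , q⊆p∪q ⁅ u ⁆ ⁅ v ⁆ (x∈⁅x⁆ v)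
                 , λ v∈ → u≢v (≡.sym (x∈⁅y⁆⇒x≡y u v∈))))

hall-subsingletons : ∀ (N : Fin m → Subset n) → Hall N →
                     Subsingletons N → SystemOfRepresentatives N
hall-subsingletons N hall unique =
  σ , section-injective N hall unique σ σ∈N , σ∈N
  where
  representative : ∀ v → Nonempty (N v)
  representative v
    with y , y∈ ← 0<∣p∣⇒Nonempty (image N ⁅ v ⁆)
                    (ℕ.≤-trans (ℕ.≤-reflexive (≡.sym (∣⁅x⁆∣≡1 v))) (hall ⁅ v ⁆))
    with w , w∈ , y∈Nw ← ∈-image⁻ N y∈
    with ≡.refl ← x∈⁅y⁆⇒x≡y v w∈ = y , y∈Nw

  σ = proj₁ ∘ representative
  σ∈N = proj₂ ∘ representative

-- While some vertex has two neighbours, one of the two edges can be deleted without breaking Hall's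
-- condition. The number of edges drops each time, and the process ends with at most one neighbour
-- per vertex, where the representatives are forced.
hall-theorem : ∀ (N : Fin m → Subset n) → Hall N → SystemOfRepresentatives N
hall-theorem N = go N (<-wellFounded _)
  where
  go : ∀ (N : Fin m → Subset n) → Acc ℕ._<_ (sumℕ (∣_∣ ∘ N)) → Hall N → SystemOfRepresentatives N
  remove-and-go : ∀ (N : Fin m → Subset n) → Acc ℕ._<_ (sumℕ (∣_∣ ∘ N)) → ∀ {v y} → y ∈ N v →
                  Hall (remove N v y) → SystemOfRepresentatives N

  go N rec hall
    with any? (λ v → any? λ y₁ → any? λ y₂ → ¬? (y₁ ≟ y₂) ×-dec (y₁ ∈? N v) ×-dec (y₂ ∈? N v))
  ... | no none = hall-subsingletons N hall unique
    where
    unique : Subsingletons N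
    unique v {y₁} {y₂} y₁∈ y₂∈ with y₁ ≟ y₂
    ... | yes y₁≡y₂ = y₁≡y₂
    ... | no  y₁≢y₂ = contradiction (v , y₁ , y₂ , y₁≢y₂ , y₁∈ , y₂∈) none
  ... | yes (v , y₁ , y₂ , y₁≢y₂ , y₁∈ , y₂∈) with remove-preserves-Hall N y₁≢y₂ hall
  ...   | inj₁ hall₁ = remove-and-go N rec y₁∈ hall₁
  ...   | inj₂ hall₂ = remove-and-go N rec y₂∈ hall₂

  remove-and-go N (acc rec) {v} {y} y∈ hall
    with σ , injective , σ∈ ← go (remove N v y)
           (rec (sumℕ-mono-< (λ w → p⊆q⇒∣p∣≤∣q∣ (remove-⊆ N v y w)) v (remove-< N y∈))) hall
    = σ , injective , λ w → remove-⊆ N v y w (σ∈ w)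

-- Barriers obtained from violators of Hall's condition

∣p∩∁q∣+∣p∩q∣≡∣p∣ : ∀ {n} (p q : Subset n) → ∣ p ∩ ∁ q ∣ ℕ.+ ∣ p ∩ q ∣ ≡ ∣ p ∣
∣p∩∁q∣+∣p∩q∣≡∣p∣ [] [] = ≡.refl
∣p∩∁q∣+∣p∩q∣≡∣p∣ (outside ∷ p) (_       ∷ q) = ∣p∩∁q∣+∣p∩q∣≡∣p∣ p q
∣p∩∁q∣+∣p∩q∣≡∣p∣ (inside  ∷ p) (outside ∷ q) = ≡.cong ℕ.suc (∣p∩∁q∣+∣p∩q∣≡∣p∣ p q)
∣p∩∁q∣+∣p∩q∣≡∣p∣ (inside  ∷ p) (inside  ∷ q) =
  ≡.trans (ℕ.+-suc _ _) (≡.cong ℕ.suc (∣p∩∁q∣+∣p∩q∣≡∣p∣ p q))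

∣p∩∁q∣+∣q∩∁p∣≤n : ∀ {n} (p q : Subset n) → ∣ p ∩ ∁ q ∣ ℕ.+ ∣ q ∩ ∁ p ∣ ℕ.≤ n
∣p∩∁q∣+∣q∩∁p∣≤n [] [] = z≤n
∣p∩∁q∣+∣q∩∁p∣≤n (outside ∷ p) (outside ∷ q) = ℕ.m≤n⇒m≤1+n (∣p∩∁q∣+∣q∩∁p∣≤n p q)
∣p∩∁q∣+∣q∩∁p∣≤n (outside ∷ p) (inside  ∷ q) =
  ℕ.≤-trans (ℕ.≤-reflexive (ℕ.+-suc _ _)) (s≤s (∣p∩∁q∣+∣q∩∁p∣≤n p q))
∣p∩∁q∣+∣q∩∁p∣≤n (inside  ∷ p) (outside ∷ q) = s≤s (∣p∩∁q∣+∣q∩∁p∣≤n p q)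
∣p∩∁q∣+∣q∩∁p∣≤n (inside  ∷ p) (inside  ∷ q) = ℕ.m≤n⇒m≤1+n (∣p∩∁q∣+∣q∩∁p∣≤n p q)

module _ {n : ℕ} (G : Graph n) where
  open Graph G

  ∈-neighbours⁺ : ∀ {u v} → T (adj u v) → v ∈ neighbours G u
  ∈-neighbours⁺ {u} {v} u~v =
    lookup⇒[]= v _ (≡.trans (lookup∘tabulate (adj u) v) (Equivalence.to T-≡ u~v))

  ∈-neighbours⁻ : ∀ {u v} → v ∈ neighbours G u → T (adj u v)
  ∈-neighbours⁻ {u} {v} v∈ =
    Equivalence.from T-≡ (≡.trans (≡.sym (lookup∘tabulate (adj u) v)) ([]=⇒lookup v∈))

  ~-sym : ∀ {u v} → T (adj u v) → T (adj v u)
  ~-sym {u} {v} = ≡.subst T (adj-sym u v)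

  -- Independence of `I` is not a separate field: it follows from `disjoint` and `I-neighbours`.
  record Barrier : Set where
    field
      I S          : Subset n
      ∣S∣<∣I∣      : ∣ S ∣ ℕ.< ∣ I ∣
      ∣I∣+∣S∣≤n    : ∣ I ∣ ℕ.+ ∣ S ∣ ℕ.≤ n
      disjoint     : ∀ {v} → v ∈ I → v ∉ S
      I-neighbours : ∀ {u v} → u ∈ I → T (adj u v) → v ∈ S

  -- A vertex of `X` outside `Y` has no neighbour in `X`, as that neighbour would put it into `Y`.
  -- Cancelling `X ∩ Y` from both sides keeps the deficiency.
  violator⇒barrier : Violator (neighbours G) → Barrier
  violator⇒barrier (X , ∣Y∣<∣X∣) = record
    { I            = X ∩ ∁ Y
    ; S            = Y ∩ ∁ X
    ; ∣S∣<∣I∣      = ℕ.+-cancelʳ-< ∣ X ∩ Y ∣ _ _ sizes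
    ; ∣I∣+∣S∣≤n    = ∣p∩∁q∣+∣q∩∁p∣≤n X Y
    ; disjoint     = λ v∈I v∈S →
        x∈∁p⇒x∉p (proj₂ (x∈p∩q⁻ X (∁ Y) v∈I)) (proj₁ (x∈p∩q⁻ Y (∁ X) v∈S))
    ; I-neighbours = λ u∈I u~v → let u∈X , u∈∁Y = x∈p∩q⁻ X (∁ Y) u∈I in
        x∈p∩q⁺ ( ∈-image⁺ N u∈X (∈-neighbours⁺ u~v)
               , x∉p⇒x∈∁p (λ v∈X → x∈∁p⇒x∉p u∈∁Y (∈-image⁺ N v∈X (∈-neighbours⁺ (~-sym u~v)))))
    }
    where
    N = neighbours G
    Y = image N X
    open ℕ.≤-Reasoning
    sizes : ∣ Y ∩ ∁ X ∣ ℕ.+ ∣ X ∩ Y ∣ ℕ.< ∣ X ∩ ∁ Y ∣ ℕ.+ ∣ X ∩ Y ∣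
    sizes = begin-strict
      ∣ Y ∩ ∁ X ∣ ℕ.+ ∣ X ∩ Y ∣   ≡⟨ ≡.cong (λ p → ∣ Y ∩ ∁ X ∣ ℕ.+ ∣ p ∣) (∩-comm X Y) ⟩
      ∣ Y ∩ ∁ X ∣ ℕ.+ ∣ Y ∩ X ∣   ≡⟨ ∣p∩∁q∣+∣p∩q∣≡∣p∣ Y X ⟩
      ∣ Y ∣                       <⟨ ∣Y∣<∣X∣ ⟩
      ∣ X ∣                       ≡⟨ ∣p∩∁q∣+∣p∩q∣≡∣p∣ X Y ⟨
      ∣ X ∩ ∁ Y ∣ ℕ.+ ∣ X ∩ Y ∣   ∎

module _ {ℓ} (ℝ : CompleteOrderedField ℓ) where
  open Real ℝ hiding (_≟_)
  open Real ℝ using () renaming (_≟_ to _≈?_)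
  open CommutativeRing commutativeRing
    using ( commutativeSemiring; semiring; refl; sym; trans; reflexive; setoid
          ; +-cong; +-congˡ; +-congʳ; +-comm; +-identityˡ; +-identityʳ
          ; -‿inverseˡ; -‿cong
          ; *-cong; *-congˡ; *-congʳ; *-comm; *-assoc; *-identityˡ; *-identityʳ
          ; zeroˡ; zeroʳ; distribˡ; distribʳ)
  open SquareRoot hiding (expand)
  open import Algebra.Solver.Ring.NaturalCoefficients.Default commutativeSemiring
    using (solve; _:+_; _:*_; _:=_; con)
  open import Algebra.Properties.Semiring.Sum semiring
    using ( sum; sum-cong-≋; ∑-distrib-+; ∑-comm; *-distribˡ-sum; *-distribʳ-sum
          ; sum-replicate-zero; sum-replicate)
  open import Algebra.Properties.Semiring.Mult semiring using (×1-homo-*)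

  ≤-poset : Poset ℓ ℓ ℓ
  ≤-poset = record { isPartialOrder = IsDecTotalOrder.isPartialOrder isDecTotalOrder }

  import Relation.Binary.Reasoning.PartialOrder ≤-poset as ≤-Reasoning
  import Relation.Binary.Reasoning.Setoid setoid as ≈-Reasoning

  -- Inequalities in the ordered field and finite sums

  +-mono-≤ : ∀ {x y z w} → x ≤ y → z ≤ w → x + z ≤ y + w
  +-mono-≤ x≤y z≤w = ≤-trans (+-monoˡ-≤ _ x≤y) (+-monoʳ-≤ _ z≤w)

  *-monoʳ-≤ : ∀ {z x y} → 0# ≤ z → x ≤ y → x * z ≤ y * z
  *-monoʳ-≤ 0≤z x≤y = ≤-resp (*-comm _ _) (*-comm _ _) (*-monoˡ-≤ 0≤z x≤y)

  *-cancelʳ-≤ : ∀ {z x y} → 0# ≤ z → ¬ z ≈ 0# → x * z ≤ y * z → x ≤ y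
  *-cancelʳ-≤ 0≤z z≉0 p = *-cancelˡ-≤ 0≤z z≉0 (≤-resp (*-comm _ _) (*-comm _ _) p)

  x²≈0⇒x≈0 : ∀ {x} → x * x ≈ 0# → x ≈ 0#
  x²≈0⇒x≈0 {x} x²≈0 with x ≈? 0#
  ... | yes x≈0 = x≈0
  ... | no  x≉0 = begin
    x                ≈⟨ *-identityʳ x ⟨
    x * 1#           ≈⟨ *-congˡ (*-inverseʳ x x≉0) ⟨
    x * (x * x ⁻¹)   ≈⟨ *-assoc x x (x ⁻¹) ⟨
    x * x * x ⁻¹     ≈⟨ *-congʳ x²≈0 ⟩
    0# * x ⁻¹        ≈⟨ zeroˡ _ ⟩
    0#               ∎
    where
    open ≈-Reasoning

  -- The difference is `(x - y)²`. Writing `x` as `w + y` with `w = x - y` makes the expansion a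
  -- subtraction-free identity, as `solve` over a semiring requires.
  2xy≤x²+y² : ∀ x y → x * y + x * y ≤ x * x + y * y
  2xy≤x²+y² x y = ≤-resp
    (+-cong (*-congʳ x-y+y≈x) (*-congʳ x-y+y≈x))
    (trans (expand (x - y) y) (+-congʳ (*-cong x-y+y≈x x-y+y≈x)))
    (0≤⇒x≤x+ _ (0≤x² (x - y)))
    where
    x-y+y≈x = -‿+-cancel y x
    expand : ∀ w y → ((w + y) * y + (w + y) * y) + w * w ≈ (w + y) * (w + y) + y * y
    expand = solve 2 (λ w y → ((w :+ y) :* y :+ (w :+ y) :* y) :+ w :* w
                            := (w :+ y) :* (w :+ y) :+ y :* y) refl

  xy≤x²+y² : ∀ x y → x * y ≤ x * x + y * y
  xy≤x²+y² x y with total 0# (x * y)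
  ... | inj₁ 0≤xy = ≤-trans (0≤⇒x≤x+ (x * y) 0≤xy) (2xy≤x²+y² x y)
  ... | inj₂ xy≤0 = ≤-trans xy≤0 (0≤+ (0≤x² x) (0≤x² y))

  -- The difference of the two sides is `(x + 2y)²`. It serves to recover a coordinate `x` from the
  -- completed pivot `x + y`.
  x²≤2[x+y]²+2y² : ∀ x y →
    x * x ≤ ((x + y) * (x + y) + (x + y) * (x + y)) + (y * y + y * y)
  x²≤2[x+y]²+2y² x y = ≤-resp refl (expand x y) (0≤⇒x≤x+ (x * x) (0≤x² (x + y + y)))
    where
    expand : ∀ x y → x * x + (x + y + y) * (x + y + y)
           ≈ ((x + y) * (x + y) + (x + y) * (x + y)) + (y * y + y * y)
    expand = solve 2 (λ x y → x :* x :+ (x :+ y :+ y) :* (x :+ y :+ y)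
      := ((x :+ y) :* (x :+ y) :+ (x :+ y) :* (x :+ y)) :+ (y :* y :+ y :* y)) refl

  sum-mono-≤ : ∀ {n} {f g : Vector Carrier n} → (∀ i → f i ≤ g i) → sum f ≤ sum g
  sum-mono-≤ {ℕ.zero}  f≤g = ≤-refl
  sum-mono-≤ {ℕ.suc n} f≤g = +-mono-≤ (f≤g zero) (sum-mono-≤ (f≤g ∘ suc))

  sum-nonNegative : ∀ {n} {f : Vector Carrier n} → (∀ i → 0# ≤ f i) → 0# ≤ sum f
  sum-nonNegative {n} 0≤f = ≤-resp (sum-replicate-zero n) refl (sum-mono-≤ 0≤f)

  term≤sum : ∀ {n} {f : Vector Carrier n} → (∀ i → 0# ≤ f i) → ∀ i → f i ≤ sum f
  term≤sum 0≤f zero    = 0≤⇒x≤x+ _ (sum-nonNegative (0≤f ∘ suc))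
  term≤sum 0≤f (suc i) = ≤-trans (term≤sum (0≤f ∘ suc) i)
    (≤-resp refl (+-comm _ _) (0≤⇒x≤x+ _ (0≤f zero)))

  indicator : Bool → Carrier
  indicator b = if b then 1# else 0#

  ∑-indicator-≟ : ∀ {n} (i : Fin n) (f : Vector Carrier n) →
                  ∑[ j < n ] (indicator (does (i ≟ j)) * f j) ≈ f i
  ∑-indicator-≟ {ℕ.suc n} zero f = begin
    1# * f zero + ∑[ j < n ] (0# * f (suc j))
      ≈⟨ +-cong (*-identityˡ _) (trans (sum-cong-≋ {n} λ j → zeroˡ _) (sum-replicate-zero n)) ⟩
    f zero + 0#
      ≈⟨ +-identityʳ _ ⟩
    f zero ∎
    where
    open ≈-Reasoning
  ∑-indicator-≟ {ℕ.suc n} (suc i) f =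
    trans (+-cong (zeroˡ _) (∑-indicator-≟ i (f ∘ suc))) (+-identityˡ _)

  -- Quadratic forms and symmetric elimination

  dot : ∀ {n} → Vector Carrier n → Vector Carrier n → Carrier
  dot {n} x y = ∑[ i < n ] (x i * y i)

  infixr 7 _⊛_
  _⊛_ : ∀ {n} → Matrix n → Vector Carrier n → Vector Carrier n
  (M ⊛ x) i = dot (M i) x

  form : ∀ {n} → Matrix n → Vector Carrier n → Carrier
  form M x = dot x (M ⊛ x)

  -- `Coercive` bounds the form below by `1/κ` times the squared norm. Keeping the inverse constant,
  -- with `1 ≤ κ`, avoids division in the induction and makes `κ` visibly nonzero.
  Symmetric PositiveSemidefinite Degenerate Coercive : ∀ {n} → Matrix n → Set ℓ
  Symmetric M = ∀ i j → M i j ≈ M j i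
  PositiveSemidefinite M = ∀ x → 0# ≤ form M x
  Degenerate M = ∃[ x ] ¬ (∀ i → x i ≈ 0#) × (∀ i → (M ⊛ x) i ≈ 0#)
  Coercive M = ∃[ κ ] 1# ≤ κ × (∀ x → dot x x ≤ κ * form M x)

  module _ {n : ℕ} where

    dot-comm : ∀ (x y : Vector Carrier n) → dot x y ≈ dot y x
    dot-comm x y = sum-cong-≋ {n} λ i → *-comm (x i) (y i)

    dot-congˡ : ∀ (x : Vector Carrier n) {y z} → (∀ i → y i ≈ z i) → dot x y ≈ dot x z
    dot-congˡ x y≈z = sum-cong-≋ {n} λ i → *-congˡ (y≈z i)

    dot-+ʳ : ∀ (x y z : Vector Carrier n) → dot x (λ i → y i + z i) ≈ dot x y + dot x z
    dot-+ʳ x y z = trans (sum-cong-≋ {n} λ i → distribˡ (x i) (y i) (z i)) (∑-distrib-+ {n} _ _)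

    dot-*ʳ : ∀ c (x y : Vector Carrier n) → dot x (λ i → c * y i) ≈ c * dot x y
    dot-*ʳ c x y = trans (sum-cong-≋ {n} λ i → x*yz (x i) c (y i)) (sym (*-distribˡ-sum {n} c _))

    dot-zeroʳ : ∀ (x : Vector Carrier n) {y} → (∀ i → y i ≈ 0#) → dot x y ≈ 0#
    dot-zeroʳ x y≈0 =
      trans (sum-cong-≋ {n} λ i → trans (*-congˡ (y≈0 i)) (zeroʳ _)) (sum-replicate-zero n)

    0≤x·x : ∀ (x : Vector Carrier n) → 0# ≤ dot x x
    0≤x·x x = sum-nonNegative λ i → 0≤x² (x i)

    x·x≈0⇒x≈0 : ∀ (x : Vector Carrier n) → dot x x ≈ 0# → ∀ i → x i ≈ 0#
    x·x≈0⇒x≈0 x x·x≈0 i = x²≈0⇒x≈0 (antisym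
      (≤-resp refl x·x≈0 (term≤sum (λ j → 0≤x² (x j)) i)) (0≤x² (x i)))

  -- A weak Cauchy-Schwarz inequality. Any constant depending on `g` alone will do, so
  -- `(x + y)² ≤ 2x² + 2y²`, applied coordinate by coordinate, is enough.
  dot-bounded : ∀ {n} (g : Vector Carrier n) →
                ∃[ K ] 0# ≤ K × (∀ y → dot g y * dot g y ≤ K * dot y y)
  dot-bounded {ℕ.zero}  g = 0# , ≤-refl , λ y → ≤-reflexive (trans (zeroʳ _) (sym (zeroʳ _)))
  dot-bounded {ℕ.suc n} g with K , 0≤K , bound ← dot-bounded (g ∘ suc) =
    (g₀² + g₀²) + (K + K) , 0≤+ 0≤2g₀² 0≤2K , λ y → begin
      dot g y * dot g y
        ≤⟨ square-bound (g zero * y zero) (dot (g ∘ suc) (y ∘ suc)) ⟩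
      (g zero * y zero * (g zero * y zero) + g zero * y zero * (g zero * y zero))
        + (dot (g ∘ suc) (y ∘ suc) * dot (g ∘ suc) (y ∘ suc)
           + dot (g ∘ suc) (y ∘ suc) * dot (g ∘ suc) (y ∘ suc))
        ≤⟨ +-monoʳ-≤ _ (+-mono-≤ (bound (y ∘ suc)) (bound (y ∘ suc))) ⟩
      (g zero * y zero * (g zero * y zero) + g zero * y zero * (g zero * y zero))
        + (K * dot (y ∘ suc) (y ∘ suc) + K * dot (y ∘ suc) (y ∘ suc))
        -- The nonnegative cross terms are added so that the sum factors as a constant times
        -- `dot y y`.
        ≤⟨ 0≤⇒x≤x+ _ (0≤+ (*-nonNegative 0≤2g₀² (0≤x·x (y ∘ suc)))
                          (*-nonNegative 0≤2K (0≤x² (y zero)))) ⟩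
      (g zero * y zero * (g zero * y zero) + g zero * y zero * (g zero * y zero))
        + (K * dot (y ∘ suc) (y ∘ suc) + K * dot (y ∘ suc) (y ∘ suc))
        + ((g₀² + g₀²) * dot (y ∘ suc) (y ∘ suc) + (K + K) * (y zero * y zero))
        ≈⟨ regroup (g zero) (y zero) K (dot (y ∘ suc) (y ∘ suc)) ⟩
      ((g₀² + g₀²) + (K + K)) * dot y y ∎
    where
    open ≤-Reasoning
    g₀² = g zero * g zero
    0≤2g₀² = 0≤+ (0≤x² (g zero)) (0≤x² (g zero))
    0≤2K = 0≤+ 0≤K 0≤K
    square : ∀ x y → (x * x + y * y) + (x * y + x * y) ≈ (x + y) * (x + y)
    square = solve 2 (λ x y → (x :* x :+ y :* y) :+ (x :* y :+ x :* y)
                            := (x :+ y) :* (x :+ y)) refl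
    double : ∀ x y → (x + y) + (x + y) ≈ (x + x) + (y + y)
    double = solve 2 (λ x y → (x :+ y) :+ (x :+ y) := (x :+ x) :+ (y :+ y)) refl
    square-bound : ∀ x y → (x + y) * (x + y) ≤ (x * x + x * x) + (y * y + y * y)
    square-bound x y = ≤-resp (square x y) (double (x * x) (y * y))
      (+-monoʳ-≤ (x * x + y * y) (2xy≤x²+y² x y))
    regroup : ∀ g y K d →
      (g * y * (g * y) + g * y * (g * y)) + (K * d + K * d)
        + ((g * g + g * g) * d + (K + K) * (y * y))
      ≈ ((g * g + g * g) + (K + K)) * (y * y + d)
    regroup = solve 4 (λ g y K d →
      (g :* y :* (g :* y) :+ g :* y :* (g :* y)) :+ (K :* d :+ K :* d)
        :+ ((g :* g :+ g :* g) :* d :+ (K :+ K) :* (y :* y))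
      := ((g :* g :+ g :* g) :+ (K :+ K)) :* (y :* y :+ d)) refl

  form-∷ : ∀ {n} (N : Matrix (ℕ.suc n)) → Symmetric N → ∀ x → let y = x ∘ suc; β = dot (N zero ∘ suc) y in
           form N x ≈ x zero * (N zero zero * x zero + β)
                      + (x zero * β + form (λ i j → N (suc i) (suc j)) y)
  form-∷ N N-sym x = +-congˡ (begin
    dot y (λ i → N (suc i) zero * x zero + (C ⊛ y) i)
      ≈⟨ dot-+ʳ y _ _ ⟩
    dot y (λ i → N (suc i) zero * x zero) + form C y
      ≈⟨ +-congʳ (dot-congˡ y λ i → trans (*-comm _ _) (*-congˡ (N-sym (suc i) zero))) ⟩
    dot y (λ i → x zero * N zero (suc i)) + form C y
      ≈⟨ +-congʳ (trans (dot-*ʳ (x zero) y _) (*-congˡ (dot-comm y _))) ⟩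
    x zero * dot (N zero ∘ suc) y + form C y ∎)
    where
    open ≈-Reasoning
    y = x ∘ suc
    C = λ i j → N (suc i) (suc j)

  -- The vector `g` plays the role of the first row divided by the pivot. It is a parameter tied to
  -- the row only by `αg≈b`, so that a zero pivot with a zero row is covered too, by `g = 0`.
  module SchurComplement {n : ℕ} (N : Matrix (ℕ.suc n)) (N-sym : Symmetric N)
    (g : Vector Carrier n) (αg≈b : ∀ i → N zero zero * g i ≈ N zero (suc i)) where
    private
      α = N zero zero

    complement : Matrix n
    complement i j = N (suc i) (suc j) - α * (g i * g j)

    complement-sym : Symmetric complement
    complement-sym i j = +-cong (N-sym (suc i) (suc j)) (-‿cong (*-congˡ (*-comm (g i) (g j))))

    pivot : Vector Carrier (ℕ.suc n) → Carrier
    pivot x = x zero + dot g (x ∘ suc)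

    head-row : ∀ x → (N ⊛ x) zero ≈ α * pivot x
    head-row x = begin
      α * x zero + dot (N zero ∘ suc) (x ∘ suc)
        ≈⟨ +-congˡ (sum-cong-≋ {n} λ i → trans (*-congʳ (sym (αg≈b i))) (*-assoc _ _ _)) ⟩
      α * x zero + sum (λ i → α * (g i * x (suc i)))
        ≈⟨ +-congˡ (*-distribˡ-sum {n} α _) ⟨
      α * x zero + α * dot g (x ∘ suc)
        ≈⟨ distribˡ α _ _ ⟨
      α * pivot x ∎
      where
      open ≈-Reasoning

    tail-row : ∀ x i → (N ⊛ x) (suc i) ≈ (α * pivot x) * g i + (complement ⊛ (x ∘ suc)) i
    tail-row x i = begin
      N (suc i) zero * x zero + ∑[ j < n ] (N (suc i) (suc j) * x (suc j))
        ≈⟨ +-cong (*-congʳ (trans (N-sym (suc i) zero) (sym (αg≈b i))))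
                  (sum-cong-≋ {n} λ j → trans (*-congʳ (sym (-‿+-cancel (α * (g i * g j)) _)))
                    (split (complement i j) α (g i) (g j) (x (suc j)))) ⟩
      α * g i * x zero + ∑[ j < n ] (complement i j * x (suc j) + α * g i * (g j * x (suc j)))
        ≈⟨ +-congˡ (trans (∑-distrib-+ {n} _ _) (+-congˡ (sym (*-distribˡ-sum {n} (α * g i) _)))) ⟩
      α * g i * x zero + ((complement ⊛ (x ∘ suc)) i + α * g i * dot g (x ∘ suc))
        ≈⟨ regroup α (g i) (x zero) ((complement ⊛ (x ∘ suc)) i) (dot g (x ∘ suc)) ⟩
      (α * pivot x) * g i + (complement ⊛ (x ∘ suc)) i ∎
      where
      open ≈-Reasoning
      split : ∀ c α g h y → (c + α * (g * h)) * y ≈ c * y + α * g * (h * y)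
      split = solve 5 (λ c α g h y → (c :+ α :* (g :* h)) :* y
                                  := c :* y :+ α :* g :* (h :* y)) refl
      regroup : ∀ α g x c γ → α * g * x + (c + α * g * γ) ≈ (α * (x + γ)) * g + c
      regroup = solve 5 (λ α g x c γ → α :* g :* x :+ (c :+ α :* g :* γ)
                                    := (α :* (x :+ γ)) :* g :+ c) refl

    -- Completing the square in the head coordinate: `pivot x` is the linear form that gets squared,
    -- and the complement is what remains.
    form-complement : ∀ x → form N x ≈ α * (pivot x * pivot x) + form complement (x ∘ suc)
    form-complement x = begin
      x zero * (N ⊛ x) zero + dot y (λ i → (N ⊛ x) (suc i))
        ≈⟨ +-cong (*-congˡ (head-row x)) (dot-congˡ y (tail-row x)) ⟩
      x zero * (α * pivot x) + dot y (λ i → (α * pivot x) * g i + (complement ⊛ y) i)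
        ≈⟨ +-congˡ (trans (dot-+ʳ y _ _)
             (+-congʳ (trans (dot-*ʳ _ y g) (*-congˡ (dot-comm y g))))) ⟩
      x zero * (α * pivot x) + ((α * pivot x) * dot g y + form complement y)
        ≈⟨ regroup (x zero) (α * pivot x) (dot g y) (form complement y) ⟩
      (α * pivot x) * pivot x + form complement y
        ≈⟨ +-congʳ (*-assoc _ _ _) ⟩
      α * (pivot x * pivot x) + form complement y ∎
      where
      open ≈-Reasoning
      y = x ∘ suc
      regroup : ∀ x p γ f → x * p + (p * γ + f) ≈ p * (x + γ) + f
      regroup = solve 4 (λ x p γ f → x :* p :+ (p :* γ :+ f) := p :* (x :+ γ) :+ f) refl

    -- The head coordinate is chosen to make `pivot` vanish, so that on lifted vectors `N` acts
    -- through the complement alone.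
    lift : Vector Carrier n → Vector Carrier (ℕ.suc n)
    lift y = (- dot g y) ∷ᶠ y

    pivot-lift : ∀ y → pivot (lift y) ≈ 0#
    pivot-lift y = -‿inverseˡ _

    complement-psd : PositiveSemidefinite N → PositiveSemidefinite complement
    complement-psd psd y = ≤-resp refl
      (trans (form-complement (lift y))
        (trans (+-congʳ (trans (*-congˡ (trans (*-congˡ (pivot-lift y)) (zeroʳ _))) (zeroʳ _)))
          (+-identityˡ _)))
      (psd (lift y))

    null-rows : ∀ x → α * pivot x ≈ 0# → (∀ i → (complement ⊛ (x ∘ suc)) i ≈ 0#) →
                ∀ i → (N ⊛ x) i ≈ 0#
    null-rows x αp≈0 _ zero = trans (head-row x) αp≈0
    null-rows x αp≈0 cy≈0 (suc i) = trans (tail-row x i)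
      (trans (+-cong (trans (*-congʳ αp≈0) (zeroˡ _)) (cy≈0 i)) (+-identityˡ 0#))

    -- With `α = 0` the whole first row `α g` vanishes, and the first basis vector is a null vector.
    zero-pivot-degenerate : α ≈ 0# → Degenerate N
    zero-pivot-degenerate α≈0 =
      (1# ∷ᶠ λ _ → 0#) , (λ x≈0 → 0≉1 (sym (x≈0 zero))) ,
      null-rows (1# ∷ᶠ λ _ → 0#) (trans (*-congʳ α≈0) (zeroˡ _)) λ i → dot-zeroʳ {n} (complement i) {λ _ → 0#} λ _ → refl

    lift-degenerate : Degenerate complement → Degenerate N
    lift-degenerate (y , y≉0 , Cy≈0) =
      lift y , (λ x≈0 → y≉0 (x≈0 ∘ suc)) ,
      null-rows (lift y) (trans (*-congˡ (pivot-lift y)) (zeroʳ α)) Cy≈0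

    -- Write γ for `dot g y`, where y is the tail of x. Then x₀ = `pivot x` - γ and γ² ≤ K (y · y),
    -- so x · x is at most 2 `pivot`² + (2K + 1)(y · y). The first square is `α ⁻¹` times its share
    -- of the form, and the tail is controlled by `κ`.
    lift-coercive : 0# ≤ α → ¬ α ≈ 0# → PositiveSemidefinite N → Coercive complement → Coercive N
    lift-coercive 0≤α α≉0 psd (κ , 1≤κ , coercive) with K , 0≤K , bound ← dot-bounded g =
      (r + r) + ((K + K) + 1#) * κ , 1≤κ′ , λ x → begin
        x zero * x zero + D x
          ≤⟨ +-monoˡ-≤ _ (x²≤2[x+y]²+2y² (x zero) (γ x)) ⟩
        (P x + P x) + (γ x * γ x + γ x * γ x) + D x
          ≤⟨ +-monoˡ-≤ _ (+-monoʳ-≤ _ (+-mono-≤ (bound (x ∘ suc)) (bound (x ∘ suc)))) ⟩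
        (P x + P x) + (K * D x + K * D x) + D x
          ≈⟨ factor (P x + P x) K (D x) ⟩
        (P x + P x) + ((K + K) + 1#) * D x
          ≤⟨ +-monoʳ-≤ _ (*-monoˡ-≤ 0≤2K+1 (coercive (x ∘ suc))) ⟩
        (P x + P x) + ((K + K) + 1#) * (κ * F x)
          -- Again the cross terms of a product are added; semidefiniteness of the complement makes
          -- the first of them nonnegative.
          ≤⟨ 0≤⇒x≤x+ _ (0≤+ (*-nonNegative 0≤2r (complement-psd psd (x ∘ suc)))
               (*-nonNegative (*-nonNegative 0≤2K+1 0≤κ) (*-nonNegative 0≤α (0≤x² (pivot x))))) ⟩
        (P x + P x) + ((K + K) + 1#) * (κ * F x)
          + ((r + r) * F x + ((K + K) + 1#) * κ * (α * P x))
          ≈⟨ +-congʳ (+-congʳ (+-cong (unscale x) (unscale x))) ⟨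
        (r * (α * P x) + r * (α * P x)) + ((K + K) + 1#) * (κ * F x)
          + ((r + r) * F x + ((K + K) + 1#) * κ * (α * P x))
          ≈⟨ regroup r (α * P x) ((K + K) + 1#) κ (F x) ⟩
        ((r + r) + ((K + K) + 1#) * κ) * (α * P x + F x)
          ≈⟨ *-congˡ (form-complement x) ⟨
        ((r + r) + ((K + K) + 1#) * κ) * form N x ∎
      where
      open ≤-Reasoning
      r = α ⁻¹
      D P F γ : Vector Carrier (ℕ.suc n) → Carrier
      D x = dot (x ∘ suc) (x ∘ suc)
      P x = pivot x * pivot x
      F x = form complement (x ∘ suc)
      γ x = dot g (x ∘ suc)
      0≤2r : 0# ≤ r + r
      0≤2r = 0≤+ (0≤x⁻¹ 0≤α α≉0) (0≤x⁻¹ 0≤α α≉0)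
      0≤2K+1 : 0# ≤ (K + K) + 1#
      0≤2K+1 = 0≤+ (0≤+ 0≤K 0≤K) 0≤1
      0≤κ : 0# ≤ κ
      0≤κ = ≤-trans 0≤1 1≤κ
      1≤κ′ : 1# ≤ (r + r) + ((K + K) + 1#) * κ
      1≤κ′ = begin
        1#                                  ≤⟨ 1≤κ ⟩
        κ                                   ≤⟨ 0≤⇒x≤x+ κ (0≤+ 0≤2r (*-nonNegative (0≤+ 0≤K 0≤K) 0≤κ)) ⟩
        κ + ((r + r) + (K + K) * κ)         ≈⟨ collect κ (r + r) (K + K) ⟩
        (r + r) + ((K + K) + 1#) * κ        ∎
        where
        collect : ∀ κ r K → κ + (r + K * κ) ≈ r + (K + 1#) * κ
        collect = solve 3 (λ κ r K → κ :+ (r :+ K :* κ) := r :+ (K :+ con 1) :* κ) refl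
      factor : ∀ p K d → p + (K * d + K * d) + d ≈ p + ((K + K) + 1#) * d
      factor = solve 3 (λ p K d → p :+ (K :* d :+ K :* d) :+ d
                               := p :+ ((K :+ K) :+ con 1) :* d) refl
      unscale : ∀ x → r * (α * P x) ≈ P x
      unscale x = trans (sym (*-assoc _ _ _))
        (trans (*-congʳ (trans (*-comm r α) (*-inverseʳ α α≉0))) (*-identityˡ _))
      regroup : ∀ r p K κ f → (r * p + r * p) + K * (κ * f) + ((r + r) * f + K * κ * p)
                            ≈ ((r + r) + K * κ) * (p + f)
      regroup = solve 5 (λ r p K κ f →
        (r :* p :+ r :* p) :+ K :* (κ :* f) :+ ((r :+ r) :* f :+ K :* κ :* p)
        := ((r :+ r) :+ K :* κ) :* (p :+ f)) refl

  form-e₀ : ∀ {n} (N : Matrix (ℕ.suc n)) → Symmetric N →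
            form N (1# ∷ᶠ λ _ → 0#) ≈ N zero zero
  form-e₀ N N-sym = begin
    form N (1# ∷ᶠ λ _ → 0#)
      ≈⟨ form-∷ N N-sym (1# ∷ᶠ λ _ → 0#) ⟩
    1# * (α * 1# + β) + (1# * β + form C (λ _ → 0#))
      ≈⟨ +-cong (*-congˡ (+-congˡ β≈0)) (+-cong (*-congˡ β≈0)
           (trans (dot-comm {n = _} (λ _ → 0#) (C ⊛ λ _ → 0#)) (dot-zeroʳ (C ⊛ λ _ → 0#) λ _ → refl))) ⟩
    1# * (α * 1# + 0#) + (1# * 0# + 0#)
      ≈⟨ simplify α ⟩
    α ∎
    where
    open ≈-Reasoning
    α = N zero zero
    C = λ i j → N (suc i) (suc j)
    β = dot (N zero ∘ suc) (λ _ → 0#)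
    β≈0 : β ≈ 0#
    β≈0 = dot-zeroʳ (N zero ∘ suc) λ _ → refl
    simplify : ∀ α → 1# * (α * 1# + 0#) + (1# * 0# + 0#) ≈ α
    simplify = solve 1 (λ α → con 1 :* (α :* con 1 :+ con 0) :+ (con 1 :* con 0 :+ con 0) := α) refl

  -- Otherwise the form would be negative at (- h , b), where b is the row and
  -- h = (c + 1) / ∣b∣² with c the value of the form at (0 , b).
  zero-pivot-row : ∀ {n} (N : Matrix (ℕ.suc n)) → Symmetric N → PositiveSemidefinite N →
                   N zero zero ≈ 0# → ∀ i → N zero (suc i) ≈ 0#
  zero-pivot-row N N-sym psd α≈0 = x·x≈0⇒x≈0 b b·b≈0
    where
    b = N zero ∘ suc
    B = dot b b
    c = form (λ i j → N (suc i) (suc j)) b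
    -- With a zero pivot the form is affine in the head coordinate, with slope twice `B`.
    value : ∀ t → form N (t ∷ᶠ b) ≈ (t * B + t * B) + c
    value t = trans (form-∷ N N-sym (t ∷ᶠ b))
      (trans (+-congʳ (*-congˡ (+-congʳ (trans (*-congʳ α≈0) (zeroˡ t)))))
        (regroup t B c))
      where
      regroup : ∀ t B c → t * (0# + B) + (t * B + c) ≈ (t * B + t * B) + c
      regroup = solve 3 (λ t B c → t :* (con 0 :+ B) :+ (t :* B :+ c)
                                := (t :* B :+ t :* B) :+ c) refl
    0≤c : 0# ≤ c
    0≤c = ≤-resp refl (trans (value 0#) (zero-terms B c)) (psd (0# ∷ᶠ b))
      where
      zero-terms : ∀ B c → (0# * B + 0# * B) + c ≈ c
      zero-terms = solve 2 (λ B c → (con 0 :* B :+ con 0 :* B) :+ c := c) refl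
    b·b≈0 : B ≈ 0#
    b·b≈0 with B ≈? 0#
    ... | yes B≈0 = B≈0
    ... | no  B≉0 = contradiction 1≤0 1≰0
      where
      open ≤-Reasoning
      h = (c + 1#) / B
      hB≈c+1 : h * B ≈ c + 1#
      hB≈c+1 = trans (*-comm h B) (*-/-cancel (c + 1#) B≉0)
      cancel : ((- h) * B + (- h) * B) + c + (h * B + h * B) ≈ c
      cancel = trans (collect (- h) h B c)
        (trans (+-congʳ (trans (*-congʳ (-‿inverseˡ h)) (zeroˡ _))) (+-identityˡ c))
        where
        collect : ∀ m h B c → (m * B + m * B) + c + (h * B + h * B) ≈ (m + h) * (B + B) + c
        collect = solve 4 (λ m h B c → (m :* B :+ m :* B) :+ c :+ (h :* B :+ h :* B)
                                    := (m :+ h) :* (B :+ B) :+ c) refl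
      1≤0 : 1# ≤ 0#
      1≤0 = +-cancelʳ-≤ c (begin
        1# + c
          ≤⟨ 0≤⇒x≤x+ (1# + c) (0≤+ 0≤c 0≤1) ⟩
        (1# + c) + (c + 1#)
          ≈⟨ +-cong (+-comm c 1#) refl ⟨
        (c + 1#) + (c + 1#)
          ≈⟨ trans (+-identityˡ _) (+-cong hB≈c+1 hB≈c+1) ⟨
        0# + (h * B + h * B)
          ≤⟨ +-monoˡ-≤ _ (psd ((- h) ∷ᶠ b)) ⟩
        form N ((- h) ∷ᶠ b) + (h * B + h * B)
          ≈⟨ +-congʳ (value (- h)) ⟩
        ((- h) * B + (- h) * B) + c + (h * B + h * B)
          ≈⟨ cancel ⟩
        c
          ≈⟨ +-identityˡ c ⟨
        0# + c ∎)

  -- Symmetric Gaussian elimination. A zero pivot settles the matter at once; with a nonzero pivot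
  -- both alternatives carry over from the Schur complement, and the empty matrix is coercive.
  degenerate-or-coercive : ∀ {n} (N : Matrix n) → Symmetric N → PositiveSemidefinite N →
                           Degenerate N ⊎ Coercive N
  degenerate-or-coercive {ℕ.zero} N _ _ = inj₂ (1# , ≤-refl , λ x → ≤-reflexive (sym (*-identityˡ _)))
  degenerate-or-coercive {ℕ.suc n} N N-sym psd = by-pivot (N zero zero ≈? 0#)
    where
    α = N zero zero
    g : Vector Carrier _
    g i = N zero (suc i) / α
    by-pivot : Dec (α ≈ 0#) → Degenerate N ⊎ Coercive N
    by-pivot (yes α≈0) = inj₁ (zero-pivot-degenerate α≈0)
      where
      α*0≈row : ∀ i → α * 0# ≈ N zero (suc i)
      α*0≈row i = trans (zeroʳ α) (sym (zero-pivot-row N N-sym psd α≈0 i))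
      open SchurComplement N N-sym (λ _ → 0#) α*0≈row
    by-pivot (no α≉0) = Sum.map lift-degenerate (lift-coercive 0≤α α≉0 psd)
      (degenerate-or-coercive complement complement-sym (complement-psd psd))
      where
      αg≈row : ∀ i → α * g i ≈ N zero (suc i)
      αg≈row i = *-/-cancel (N zero (suc i)) α≉0
      open SchurComplement N N-sym g αg≈row
      0≤α : 0# ≤ α
      0≤α = ≤-resp refl (form-e₀ N N-sym) (psd (1# ∷ᶠ λ _ → 0#))

  -- Rayleigh quotients and the largest eigenvalue

  -- It only has to guarantee that the Rayleigh quotients have a supremum, so each entry is
  -- estimated separately and crudely.
  form-bounded : ∀ {n} (M : Matrix n) → ∃[ K ] (∀ x → form M x ≤ K * dot x x)
  form-bounded {n} M = ∑[ i < n ] ∑[ j < n ] (M i j * M i j + 1#) , λ x → begin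
    form M x
      ≈⟨ sum-cong-≋ {n} (λ i → *-distribˡ-sum {n} (x i) _) ⟩
    ∑[ i < n ] ∑[ j < n ] (x i * (M i j * x j))
      ≤⟨ sum-mono-≤ (λ i → sum-mono-≤ λ j → entry x i j) ⟩
    ∑[ i < n ] ∑[ j < n ] ((M i j * M i j + 1#) * dot x x)
      ≈⟨ sum-cong-≋ {n} (λ i → *-distribʳ-sum {n} (dot x x) _) ⟨
    ∑[ i < n ] (∑[ j < n ] (M i j * M i j + 1#) * dot x x)
      ≈⟨ *-distribʳ-sum {n} (dot x x) _ ⟨
    ∑[ i < n ] ∑[ j < n ] (M i j * M i j + 1#) * dot x x ∎
    where
    open ≤-Reasoning
    x²≤x·x : ∀ x i → x i * x i ≤ dot x x
    x²≤x·x x = term≤sum λ j → 0≤x² (x j)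
    entry : ∀ x i j → x i * (M i j * x j) ≤ (M i j * M i j + 1#) * dot x x
    entry x i j = begin
      x i * (M i j * x j)
        ≈⟨ *-assoc _ _ _ ⟨
      x i * M i j * x j
        ≤⟨ xy≤x²+y² (x i * M i j) (x j) ⟩
      x i * M i j * (x i * M i j) + x j * x j
        ≈⟨ regroup (x i) (M i j) (x j * x j) ⟩
      M i j * M i j * (x i * x i) + x j * x j
        ≤⟨ +-mono-≤ (*-monoˡ-≤ (0≤x² (M i j)) (x²≤x·x x i)) (x²≤x·x x j) ⟩
      M i j * M i j * dot x x + dot x x
        ≈⟨ factor (M i j * M i j) (dot x x) ⟩
      (M i j * M i j + 1#) * dot x x ∎
      where
      regroup : ∀ x m y → x * m * (x * m) + y ≈ m * m * (x * x) + y
      regroup = solve 3 (λ x m y → x :* m :* (x :* m) :+ y := m :* m :* (x :* x) :+ y) refl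
      factor : ∀ m d → m * d + d ≈ (m + 1#) * d
      factor = solve 2 (λ m d → m :* d :+ d := (m :+ con 1) :* d) refl

  infixl 6 _I-_
  _I-_ : ∀ {n} → Carrier → Matrix n → Matrix n
  (μ I- M) i j = μ * indicator (does (i ≟ j)) - M i j

  module _ {n : ℕ} (M : Matrix n) where

    I-‿row : ∀ μ x i → ((μ I- M) ⊛ x) i + (M ⊛ x) i ≈ μ * x i
    I-‿row μ x i = begin
      ((μ I- M) ⊛ x) i + (M ⊛ x) i
        ≈⟨ ∑-distrib-+ {n} _ _ ⟨
      ∑[ j < n ] ((μ I- M) i j * x j + M i j * x j)
        ≈⟨ sum-cong-≋ {n} (λ j → trans (sym (distribʳ _ _ _)) (*-congʳ (-‿+-cancel _ _))) ⟩
      ∑[ j < n ] (μ * indicator (does (i ≟ j)) * x j)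
        ≈⟨ sum-cong-≋ {n} (λ j → *-assoc _ _ _) ⟩
      ∑[ j < n ] (μ * (indicator (does (i ≟ j)) * x j))
        ≈⟨ *-distribˡ-sum {n} μ _ ⟨
      μ * ∑[ j < n ] (indicator (does (i ≟ j)) * x j)
        ≈⟨ *-congˡ (∑-indicator-≟ i x) ⟩
      μ * x i ∎
      where
      open ≈-Reasoning

    form-I-‿ : ∀ μ x → form (μ I- M) x + form M x ≈ μ * dot x x
    form-I-‿ μ x = trans (sym (dot-+ʳ x _ _))
      (trans (dot-congˡ x (I-‿row μ x)) (dot-*ʳ μ x x))

    -- The downward closure of the set of Rayleigh quotients, written without division. It has the
    -- same supremum, and a lower estimate of one quotient is already a member.
    RayleighBound : Carrier → Set ℓ
    RayleighBound c = ∃[ x ] ¬ (∀ i → x i ≈ 0#) × c * dot x x ≤ form M x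

    rayleighBound-≤ : ∀ {c K x} → ¬ (∀ i → x i ≈ 0#) → c * dot x x ≤ form M x →
                      form M x ≤ K * dot x x → c ≤ K
    rayleighBound-≤ {x = x} x≉0 lower upper =
      *-cancelʳ-≤ (0≤x·x x) (x≉0 ∘ x·x≈0⇒x≈0 x) (≤-trans lower upper)

    -- The supremum μ of the Rayleigh quotient is an eigenvalue: if the positive
    -- semidefinite matrix μ I - M were coercive, μ could be lowered.
    rayleighBound≤largestEigenvalue : Symmetric M → ∀ {λ₁} → IsLargestEigenvalue M λ₁ →
                                      ∀ {c} → RayleighBound c → c ≤ λ₁
    rayleighBound≤largestEigenvalue M-sym (_ , largest) {c} c-bound
      with K , form≤K ← form-bounded M
      with μ , μ-upper , μ-least ← supremum RayleighBound (c , c-bound)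
             (K , λ _ (x , x≉0 , lower) → rayleighBound-≤ x≉0 lower (form≤K x))
      = conclude (degenerate-or-coercive (μ I- M) sym-μ psd)
      where
      sym-indicator : ∀ i j → indicator (does (i ≟ j)) ≈ indicator (does (j ≟ i))
      sym-indicator i j with i ≟ j | j ≟ i
      ... | yes _   | yes _   = refl
      ... | no  _   | no  _   = refl
      ... | yes i≡j | no  j≢i = contradiction (≡.sym i≡j) j≢i
      ... | no  i≢j | yes j≡i = contradiction (≡.sym j≡i) i≢j
      sym-μ : Symmetric (μ I- M)
      sym-μ i j = +-cong (*-congˡ (sym-indicator i j)) (-‿cong (M-sym i j))

      form≤μ : ∀ x → form M x ≤ μ * dot x x
      form≤μ x with dot x x ≈? 0#
      -- The zero vector has no quotient; both sides vanish.
      ... | yes x·x≈0 = ≤-reflexive (trans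
        (trans (dot-comm x _) (dot-zeroʳ (M ⊛ x) (x·x≈0⇒x≈0 x x·x≈0)))
        (sym (trans (*-congˡ x·x≈0) (zeroʳ μ))))
      ... | no  x·x≉0 = ≤-resp quotient refl
        (*-monoʳ-≤ (0≤x·x x) (μ-upper _
          (x , (λ x≈0 → x·x≉0 (dot-zeroʳ x x≈0)) , ≤-reflexive quotient)))
        where
        quotient : form M x / dot x x * dot x x ≈ form M x
        quotient = trans (*-comm _ _) (*-/-cancel (form M x) x·x≉0)

      psd : PositiveSemidefinite (μ I- M)
      psd x = +-cancelʳ-≤ (form M x)
        (≤-resp (sym (+-identityˡ _)) (sym (form-I-‿ μ x)) (form≤μ x))

      conclude : Degenerate (μ I- M) ⊎ Coercive (μ I- M) → c ≤ _
      conclude (inj₁ (x , x≉0 , null)) = ≤-trans (μ-upper c c-bound)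
        (largest μ (x , x≉0 , λ i →
          trans (sym (+-identityˡ _)) (trans (+-congʳ (sym (null i))) (I-‿row μ x i))))
      conclude (inj₂ (κ , 1≤κ , coercive)) = contradiction 1≤0 1≰0
        where
        open ≤-Reasoning
        0≤κ : 0# ≤ κ
        0≤κ = ≤-trans 0≤1 1≤κ
        κ≉0 : ¬ κ ≈ 0#
        κ≉0 κ≈0 = 1≰0 (≤-resp refl κ≈0 1≤κ)
        r = κ ⁻¹
        rκ≈1 : r * κ ≈ 1#
        rκ≈1 = trans (*-comm r κ) (*-inverseʳ κ κ≉0)
        -- Coercivity turns `μ` times the squared norm into a bound with room `r = 1/κ` to spare, so
        -- `μ - r` would be a smaller upper bound.
        lower : ∀ d → RayleighBound d → d ≤ μ - r
        lower d (x , x≉0 , d≤) = +-cancelʳ-≤ r (≤-resp refl (sym (-‿+-cancel r μ))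
          (*-cancelʳ-≤ (0≤x·x x) (x≉0 ∘ x·x≈0⇒x≈0 x) (begin
            (d + r) * dot x x
              ≈⟨ distribʳ _ _ _ ⟩
            d * dot x x + r * dot x x
              ≤⟨ +-mono-≤ d≤ (*-monoˡ-≤ (0≤x⁻¹ 0≤κ κ≉0) (coercive x)) ⟩
            form M x + r * (κ * form (μ I- M) x)
              ≈⟨ +-congˡ (trans (sym (*-assoc _ _ _)) (trans (*-congʳ rκ≈1) (*-identityˡ _))) ⟩
            form M x + form (μ I- M) x
              ≈⟨ trans (+-comm _ _) (form-I-‿ μ x) ⟩
            μ * dot x x ∎)))
        r≤0 : r ≤ 0#
        r≤0 = +-cancelʳ-≤ (μ - r) (begin
          r + (μ - r)   ≈⟨ trans (+-comm _ _) (-‿+-cancel r μ) ⟩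
          μ             ≤⟨ μ-least (μ - r) lower ⟩
          μ - r         ≈⟨ +-identityˡ _ ⟨
          0# + (μ - r)  ∎)
        1≤0 : 1# ≤ 0#
        1≤0 = ≤-resp rκ≈1 (zeroˡ κ) (*-monoʳ-≤ 0≤κ r≤0)

  -- Edge sums and the fractional matching of a permutation

  0≤indicator : ∀ b → 0# ≤ indicator b
  0≤indicator true  = 0≤1
  0≤indicator false = ≤-refl

  indicator≤1 : ∀ b → indicator b ≤ 1#
  indicator≤1 true  = ≤-refl
  indicator≤1 false = 0≤1

  indicator-yes : ∀ {p} {P : Set p} (P? : Dec P) → P → indicator (does P?) ≈ 1#
  indicator-yes P? p rewrite dec-true P? p = refl

  indicator-no : ∀ {p} {P : Set p} (P? : Dec P) → ¬ P → indicator (does P?) ≈ 0#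
  indicator-no P? ¬p rewrite dec-false P? ¬p = refl

  sum-ones : ∀ n → ∑[ i < n ] 1# ≈ fromℕ n
  sum-ones n = sum-replicate n

  ∑-indicator-≟ˡ : ∀ {n} (i : Fin n) → ∑[ j < n ] indicator (does (i ≟ j)) ≈ 1#
  ∑-indicator-≟ˡ {n} i =
    trans (sum-cong-≋ {n} λ j → sym (*-identityʳ _)) (∑-indicator-≟ i (λ _ → 1#))

  ∑-indicator-injective : ∀ {m n} (σ : Fin m → Fin n) → Injective _≡_ _≡_ σ → ∀ v →
                          ∑[ w < m ] indicator (does (σ w ≟ v)) ≤ 1#
  ∑-indicator-injective {m} σ σ-injective v = by-preimage (any? λ w → σ w ≟ v)
    where
    by-preimage : Dec (∃[ w ] σ w ≡ v) → ∑[ w < m ] indicator (does (σ w ≟ v)) ≤ 1#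
    by-preimage (yes (w₀ , σw₀≡v)) =
      ≤-trans (sum-mono-≤ pointwise) (≤-reflexive (∑-indicator-≟ˡ w₀))
      where
      pointwise : ∀ w → indicator (does (σ w ≟ v)) ≤ indicator (does (w₀ ≟ w))
      pointwise w with σ w ≟ v
      ... | yes σw≡v = ≤-reflexive
        (sym (indicator-yes (w₀ ≟ w) (σ-injective (≡.trans σw₀≡v (≡.sym σw≡v)))))
      ... | no  _    = 0≤indicator _
    by-preimage (no none) = ≤-trans
      (≤-reflexive (trans
        (sum-cong-≋ {m} λ w → indicator-no (σ w ≟ v) λ σw≡v → none (w , σw≡v))
        (sum-replicate-zero m)))
      0≤1

  fromℕ-∣∣ : ∀ {n} (p : Subset n) → fromℕ ∣ p ∣ ≈ ∑[ i < n ] indicator (lookup p i)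
  fromℕ-∣∣ []            = refl
  fromℕ-∣∣ (outside ∷ p) = trans (fromℕ-∣∣ p) (sym (+-identityˡ _))
  fromℕ-∣∣ (inside  ∷ p) = +-congˡ (fromℕ-∣∣ p)

  0≤fromℕ : ∀ m → 0# ≤ fromℕ m
  0≤fromℕ ℕ.zero    = ≤-refl
  0≤fromℕ (ℕ.suc m) = 0≤+ 0≤1 (0≤fromℕ m)

  fromℕ-mono-≤ : ∀ {m n} → m ℕ.≤ n → fromℕ m ≤ fromℕ n
  fromℕ-mono-≤ {n = n} z≤n = 0≤fromℕ n
  fromℕ-mono-≤ (s≤s m≤n)   = +-monoʳ-≤ 1# (fromℕ-mono-≤ m≤n)

  1≤fromℕ-suc : ∀ m → 1# ≤ fromℕ (ℕ.suc m)
  1≤fromℕ-suc m = 0≤⇒x≤x+ 1# (0≤fromℕ m)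

  1≤x⇒x≉0 : ∀ {x} → 1# ≤ x → ¬ x ≈ 0#
  1≤x⇒x≉0 1≤x x≈0 = 1≰0 (≤-resp refl x≈0 1≤x)

  ½ : Carrier
  ½ = 2# ⁻¹

  ½*2≈1 : ½ * (1# + 1#) ≈ 1#
  ½*2≈1 = trans (*-congˡ (+-congˡ (sym (+-identityʳ 1#))))
    (trans (*-comm ½ 2#) (*-inverseʳ 2# (1≤x⇒x≉0 (1≤fromℕ-suc 1))))

  ½*[x+x]≈x : ∀ x → ½ * (x + x) ≈ x
  ½*[x+x]≈x x = trans (factor ½ x) (trans (*-congʳ ½*2≈1) (*-identityˡ x))
    where
    factor : ∀ h x → h * (x + x) ≈ (h * (1# + 1#)) * x
    factor = solve 2 (λ h x → h :* (x :+ x) := (h :* (con 1 :+ con 1)) :* x) refl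

  0≤½ : 0# ≤ ½
  0≤½ = 0≤x⁻¹ (0≤fromℕ 2) (1≤x⇒x≉0 (1≤fromℕ-suc 1))

  module _ {n : ℕ} where

    [_<_] : Fin n → Fin n → Carrier
    [ u < v ] = indicator (does (u <? v))

    -- Off the diagonal exactly one of the two orders holds; on it neither does, which is harmless
    -- because `h` vanishes there.
    ordered-pairs : ∀ {h : Matrix n} → (∀ v → h v v ≈ 0#) →
                    ∀ u v → [ u < v ] * h u v + [ v < u ] * h u v ≈ h u v
    ordered-pairs {h} diagonal u v =
      trans (sym (distribʳ (h u v) [ u < v ] [ v < u ])) (by-order (<-cmp u v))
      where
      by-order : _ → ([ u < v ] + [ v < u ]) * h u v ≈ h u v
      by-order (tri< u<v _ v≮u) = trans
        (*-congʳ (trans (+-cong (indicator-yes (u <? v) u<v) (indicator-no (v <? u) v≮u)) (+-identityʳ 1#)))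
        (*-identityˡ _)
      by-order (tri> u≮v _ v<u) = trans
        (*-congʳ (trans (+-cong (indicator-no (u <? v) u≮v) (indicator-yes (v <? u) v<u)) (+-identityˡ 1#)))
        (*-identityˡ _)
      by-order (tri≈ _ ≡.refl _) = trans (trans (*-congˡ (diagonal u)) (zeroʳ _)) (sym (diagonal u))

    -- Each edge is counted with its smaller endpoint first; transposing the second copy of the sum
    -- supplies the opposite order.
    ∑-< : ∀ {h : Matrix n} → Symmetric h → (∀ v → h v v ≈ 0#) →
          let E = ∑[ u < n ] ∑[ v < n ] ([ u < v ] * h u v) in
          E + E ≈ ∑[ u < n ] ∑[ v < n ] h u v
    ∑-< {h} h-sym diagonal = begin
      ∑[ u < n ] ∑[ v < n ] ([ u < v ] * h u v) + ∑[ u < n ] ∑[ v < n ] ([ u < v ] * h u v)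
        ≈⟨ +-congˡ (∑-comm {n} {n} _) ⟩
      ∑[ u < n ] ∑[ v < n ] ([ u < v ] * h u v) + ∑[ u < n ] ∑[ v < n ] ([ v < u ] * h v u)
        ≈⟨ ∑-distrib-+ {n} _ _ ⟨
      ∑[ u < n ] (∑[ v < n ] ([ u < v ] * h u v) + ∑[ v < n ] ([ v < u ] * h v u))
        ≈⟨ sum-cong-≋ {n} (λ u → sym (∑-distrib-+ {n} _ _)) ⟩
      ∑[ u < n ] ∑[ v < n ] ([ u < v ] * h u v + [ v < u ] * h v u)
        ≈⟨ sum-cong-≋ {n} (λ u → sum-cong-≋ {n} λ v →
             trans (+-congˡ (*-congˡ (h-sym v u))) (ordered-pairs diagonal u v)) ⟩
      ∑[ u < n ] ∑[ v < n ] h u v ∎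
      where
      open ≈-Reasoning

    -- The Boolean disjunction is what `does (incident? G v e)` reduces to, so the left side has the
    -- shape of `incidentSum`. The pairs are split by which endpoint is `v`.
    ∑-<-at : ∀ {h : Matrix n} → Symmetric h → (∀ v → h v v ≈ 0#) → ∀ v →
             ∑[ u < n ] ∑[ w < n ]
               ([ u < w ] * (if does (v ≟ u) ∨ does (v ≟ w) then h u w else 0#))
             ≈ ∑[ w < n ] h v w
    ∑-<-at {h} h-sym diagonal v = begin
      ∑[ u < n ] ∑[ w < n ] ([ u < w ] * (if does (v ≟ u) ∨ does (v ≟ w) then h u w else 0#))
        ≈⟨ sum-cong-≋ {n} (λ u → trans (sum-cong-≋ {n} λ w → split u w) (∑-distrib-+ {n} _ _)) ⟩
      ∑[ u < n ] (∑[ w < n ] (at u * ([ u < w ] * h u w)) + ∑[ w < n ] (at w * ([ u < w ] * h u w)))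
        ≈⟨ ∑-distrib-+ {n} _ _ ⟩
      ∑[ u < n ] ∑[ w < n ] (at u * ([ u < w ] * h u w)) + ∑[ u < n ] ∑[ w < n ] (at w * ([ u < w ] * h u w))
        ≈⟨ +-cong (trans (sum-cong-≋ {n} λ u → sym (*-distribˡ-sum {n} (at u) _)) (∑-indicator-≟ v _))
                  (sum-cong-≋ {n} λ u → ∑-indicator-≟ v _) ⟩
      ∑[ w < n ] ([ v < w ] * h v w) + ∑[ w < n ] ([ w < v ] * h w v)
        ≈⟨ ∑-distrib-+ {n} _ _ ⟨
      ∑[ w < n ] ([ v < w ] * h v w + [ w < v ] * h w v)
        ≈⟨ sum-cong-≋ {n} (λ w → trans (+-congˡ (*-congˡ (h-sym w v))) (ordered-pairs diagonal v w)) ⟩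
      ∑[ w < n ] h v w ∎
      where
      open ≈-Reasoning
      at : Fin n → Carrier
      at u = indicator (does (v ≟ u))
      split : ∀ u w → [ u < w ] * (if does (v ≟ u) ∨ does (v ≟ w) then h u w else 0#)
                    ≈ at u * ([ u < w ] * h u w) + at w * ([ u < w ] * h u w)
      split u w with v ≟ u | v ≟ w
      ... | no  _      | no  _      = trans (zeroʳ _) (sym (trans (+-cong (zeroˡ _) (zeroˡ _)) (+-identityˡ _)))
      ... | no  _      | yes _      = sym (trans (+-cong (zeroˡ _) (*-identityˡ _)) (+-identityˡ _))
      ... | yes _      | no  _      = sym (trans (+-cong (*-identityˡ _) (zeroˡ _)) (+-identityʳ _))
      -- Here the right side counts the pair twice, but it is the null diagonal entry.
      ... | yes ≡.refl | yes ≡.refl =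
        trans null (sym (trans (+-cong (trans (*-identityˡ _) null) (trans (*-identityˡ _) null)) (+-identityˡ _)))
        where
        null : [ v < v ] * h v v ≈ 0#
        null = trans (*-congˡ (diagonal v)) (zeroʳ _)

  module _ {n : ℕ} (G : Graph n) where
    open Graph G

    edgeSum-≈ : ∀ {f : Edge G → Carrier} (h : Matrix n) → (∀ e → f e ≈ h (Edge.lo e) (Edge.hi e)) →
                (∀ u v → ¬ T (adj u v) → h u v ≈ 0#) →
                edgeSum G f ≈ ∑[ u < n ] ∑[ v < n ] ([ u < v ] * h u v)
    edgeSum-≈ {f} h f≈h h-null = trans (reflexive (proj₂ summand))
      (sum-cong-≋ {n} λ u → sum-cong-≋ {n} λ v → summand≈ u v)
      where
      -- The summand of edgeSum is local to its definition, so it is named by unification.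
      summand : Σ[ t ∈ Matrix n ] edgeSum G f ≡ ∑[ u < n ] ∑[ v < n ] t u v
      summand = _ , ≡.refl
      non-edge : ∀ u v → ¬ IsEdge G u v → [ u < v ] * h u v ≈ 0#
      non-edge u v ¬edge with u <? v
      ... | yes u<v = trans (*-congˡ (h-null u v λ u~v → ¬edge (u<v , u~v))) (zeroʳ _)
      ... | no  u≮v = trans (*-congʳ (indicator-no (u <? v) u≮v)) (zeroˡ _)
      summand≈ : ∀ u v → proj₁ summand u v ≈ [ u < v ] * h u v
      summand≈ u v with isEdge? G u v
      ... | yes p    = trans (f≈h (edge u v p))
        (sym (trans (*-congʳ (indicator-yes (u <? v) (proj₁ p))) (*-identityˡ _)))
      ... | no ¬edge = sym (non-edge u v ¬edge)

    -- The weights form half the sum of the permutation matrix and its transpose: an edge that is a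
    -- 2-cycle of `σ` receives weight 1, every other edge `{v , σ v}` weight ½. Vertex sums and the
    -- total become row and column sums.
    permutation⇒perfect : (σ : Fin n → Fin n) → Injective _≡_ _≡_ σ → (∀ v → T (adj v (σ v))) →
                          HasFractionalPerfectMatching G
    permutation⇒perfect σ σ-injective v~σv = f , ((λ e → bounds _ _) , incident≤1) , perfect
      where
      d h : Matrix n
      d u v = indicator (does (σ u ≟ v))
      h u v = ½ * (d u v + d v u)
      f : Edge G → Carrier
      f e = h (Edge.lo e) (Edge.hi e)

      h-sym : Symmetric h
      h-sym u v = *-congˡ (+-comm _ _)

      d-null : ∀ u v → ¬ T (adj u v) → d u v ≈ 0#
      d-null u v u≁v = indicator-no (σ u ≟ v) λ { ≡.refl → u≁v (v~σv u) }

      h-null : ∀ u v → ¬ T (adj u v) → h u v ≈ 0#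
      h-null u v u≁v = trans
        (*-congˡ (trans (+-cong (d-null u v u≁v) (d-null v u (u≁v ∘ ~-sym G))) (+-identityˡ _)))
        (zeroʳ ½)

      h-diagonal : ∀ v → h v v ≈ 0#
      h-diagonal v = h-null v v λ v~v → ≡.subst T (adj-irrefl v) v~v

      bounds : ∀ u v → 0# ≤ h u v × h u v ≤ 1#
      bounds u v =
        *-nonNegative 0≤½ (0≤+ (0≤indicator _) (0≤indicator _)) ,
        ≤-resp refl ½*2≈1 (*-monoˡ-≤ 0≤½ (+-mono-≤ (indicator≤1 _) (indicator≤1 _)))

      row-sum : ∀ v → ∑[ w < n ] h v w ≈ ½ * (1# + ∑[ w < n ] d w v)
      row-sum v = trans (sym (*-distribˡ-sum {n} ½ _))
        (*-congˡ (trans (∑-distrib-+ {n} _ _) (+-congʳ (∑-indicator-≟ˡ (σ v)))))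

      incident≤1 : ∀ v → incidentSum G f v ≤ 1#
      incident≤1 v = begin
        incidentSum G f v
          ≈⟨ edgeSum-≈ (λ u w → if does (v ≟ u) ∨ does (v ≟ w) then h u w else 0#) (λ e → refl) null ⟩
        ∑[ u < n ] ∑[ w < n ] ([ u < w ] * (if does (v ≟ u) ∨ does (v ≟ w) then h u w else 0#))
          ≈⟨ ∑-<-at h-sym h-diagonal v ⟩
        ∑[ w < n ] h v w
          ≈⟨ row-sum v ⟩
        ½ * (1# + ∑[ w < n ] d w v)
          ≤⟨ *-monoˡ-≤ 0≤½ (+-monoʳ-≤ 1# (∑-indicator-injective σ σ-injective v)) ⟩
        ½ * (1# + 1#)
          ≈⟨ ½*2≈1 ⟩
        1# ∎
        where
        open ≤-Reasoning
        null : ∀ u w → ¬ T (adj u w) → (if does (v ≟ u) ∨ does (v ≟ w) then h u w else 0#) ≈ 0#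
        null u w u≁w with does (v ≟ u) ∨ does (v ≟ w)
        ... | true  = h-null u w u≁w
        ... | false = refl

      perfect : edgeSum G f ≈ fromℕ n / 2#
      perfect = begin
        edgeSum G f
          ≈⟨ edgeSum-≈ h (λ e → refl) h-null ⟩
        E
          ≈⟨ ½*[x+x]≈x E ⟨
        ½ * (E + E)
          ≈⟨ *-congˡ (∑-< h-sym h-diagonal) ⟩
        ½ * ∑[ u < n ] ∑[ v < n ] h u v
          ≈⟨ *-congˡ (sum-cong-≋ {n} row-sum) ⟩
        ½ * ∑[ u < n ] (½ * (1# + ∑[ v < n ] d v u))
          ≈⟨ *-congˡ (*-distribˡ-sum {n} ½ _) ⟨
        ½ * (½ * ∑[ u < n ] (1# + ∑[ v < n ] d v u))
          ≈⟨ *-congˡ (*-congˡ (trans (∑-distrib-+ {n} _ _) (+-cong (sum-ones n) column-sums))) ⟩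
        ½ * (½ * (fromℕ n + fromℕ n))
          ≈⟨ *-congˡ (½*[x+x]≈x (fromℕ n)) ⟩
        ½ * fromℕ n
          ≈⟨ *-comm ½ (fromℕ n) ⟩
        fromℕ n / 2# ∎
        where
        open ≈-Reasoning
        E = ∑[ u < n ] ∑[ v < n ] ([ u < v ] * h u v)
        column-sums : ∑[ u < n ] ∑[ v < n ] d v u ≈ fromℕ n
        column-sums = trans (∑-comm {n} {n} _)
          (trans (sum-cong-≋ {n} λ v → ∑-indicator-≟ˡ (σ v)) (sum-ones n))

    perfect-or-barrier : HasFractionalPerfectMatching G ⊎ Barrier G
    perfect-or-barrier with hall? (neighbours G)
    ... | inj₁ hall with σ , σ-injective , σ∈ ← hall-theorem (neighbours G) hall =
      inj₁ (permutation⇒perfect σ σ-injective λ v → ∈-neighbours⁻ G (σ∈ v))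
    ... | inj₂ violator = inj₂ (violator⇒barrier G violator)

  -- The form of aD + A and vectors supported on a barrier

  module _ {n : ℕ} (G : Graph n) where
    open Graph G

    private
      A : Matrix n
      A = adjacencyMatrix G

    A-sym : Symmetric A
    A-sym u v = reflexive (≡.cong indicator (adj-sym u v))

    degree≈∑ : ∀ u → fromℕ (degree G u) ≈ ∑[ v < n ] A u v
    degree≈∑ u = trans (fromℕ-∣∣ (neighbours G u))
      (sum-cong-≋ {n} λ v → reflexive (≡.cong indicator (lookup∘tabulate (adj u) v)))

    degreeMatrix≈ : ∀ u v → degreeMatrix G u v ≈ indicator (does (u ≟ v)) * fromℕ (degree G u)
    degreeMatrix≈ u v with does (u ≟ v)
    ... | true  = sym (*-identityˡ _)
    ... | false = sym (zeroˡ _)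

    degreeMatrix-sym : Symmetric (degreeMatrix G)
    degreeMatrix-sym u v with u ≟ v | v ≟ u
    ... | yes ≡.refl | yes _   = refl
    ... | no  _      | no  _   = refl
    ... | yes u≡v    | no  v≢u = contradiction (≡.sym u≡v) v≢u
    ... | no  u≢v    | yes v≡u = contradiction (≡.sym v≡u) u≢v

    aD+A-sym : ∀ a → Symmetric (aD+A G a)
    aD+A-sym a u v = +-cong (*-congˡ (degreeMatrix-sym u v)) (A-sym u v)

    -- A degree is a row sum of `A`, so the diagonal term can be spread over the incident edges. The
    -- form then becomes a sum over ordered adjacent pairs and can be estimated pair by pair.
    aD+A-row : ∀ a x u → (aD+A G a ⊛ x) u ≈ ∑[ v < n ] (A u v * (a * x u + x v))
    aD+A-row a x u = begin
      (aD+A G a ⊛ x) u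
        ≈⟨ sum-cong-≋ {n} (λ v → trans (*-congʳ (+-congʳ (*-congˡ (degreeMatrix≈ u v))))
             (regroup a (indicator (does (u ≟ v))) deg (A u v) (x v))) ⟩
      ∑[ v < n ] (indicator (does (u ≟ v)) * (deg * (a * x v)) + A u v * x v)
        ≈⟨ trans (∑-distrib-+ {n} _ _) (+-congʳ (∑-indicator-≟ u _)) ⟩
      deg * (a * x u) + ∑[ v < n ] (A u v * x v)
        ≈⟨ +-congʳ (trans (*-congʳ (degree≈∑ u)) (*-distribʳ-sum {n} (a * x u) _)) ⟩
      ∑[ v < n ] (A u v * (a * x u)) + ∑[ v < n ] (A u v * x v)
        ≈⟨ ∑-distrib-+ {n} _ _ ⟨
      ∑[ v < n ] (A u v * (a * x u) + A u v * x v)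
        ≈⟨ sum-cong-≋ {n} (λ v → distribˡ _ _ _) ⟨
      ∑[ v < n ] (A u v * (a * x u + x v)) ∎
      where
      open ≈-Reasoning
      deg = fromℕ (degree G u)
      regroup : ∀ a i d A x → (a * (i * d) + A) * x ≈ i * (d * (a * x)) + A * x
      regroup = solve 5 (λ a i d A x → (a :* (i :* d) :+ A) :* x
                                    := i :* (d :* (a :* x)) :+ A :* x) refl

    form-aD+A : ∀ a x → form (aD+A G a) x ≈
                ∑[ u < n ] ∑[ v < n ] (A u v * (a * (x u * x u) + x u * x v))
    form-aD+A a x = sum-cong-≋ {n} λ u → begin
      x u * (aD+A G a ⊛ x) u
        ≈⟨ *-congˡ (aD+A-row a x u) ⟩
      x u * ∑[ v < n ] (A u v * (a * x u + x v))
        ≈⟨ *-distribˡ-sum {n} (x u) _ ⟩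
      ∑[ v < n ] (x u * (A u v * (a * x u + x v)))
        ≈⟨ sum-cong-≋ {n} (λ v → regroup a (x u) (A u v) (x v)) ⟩
      ∑[ v < n ] (A u v * (a * (x u * x u) + x u * x v)) ∎
      where
      open ≈-Reasoning
      regroup : ∀ a x A y → x * (A * (a * x + y)) ≈ A * (a * (x * x) + x * y)
      regroup = solve 4 (λ a x A y → x :* (A :* (a :* x :+ y)) := A :* (a :* (x :* x) :+ x :* y)) refl

    -- The value is `q` on `I` and `p` on `S`; leaving both free lets all ranges of `a` share the
    -- estimates.
    module TestVector (barrier : Barrier G) {p q : Carrier} (0≤p : 0# ≤ p) (0≤q : 0# ≤ q) where
      open Barrier barrier

      χ : Subset n → Fin n → Carrier
      χ X v = indicator (lookup X v)

      x : Vector Carrier n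
      x v = q * χ I v + p * χ S v

      χ-∈ : ∀ {X v} → v ∈ X → χ X v ≈ 1#
      χ-∈ {X} {v} v∈X rewrite []=⇒lookup v∈X = refl

      χ-∉ : ∀ {X v} → v ∉ X → χ X v ≈ 0#
      χ-∉ {X} {v} v∉X with lookup X v in eq
      ... | true  = contradiction (lookup⇒[]= v X eq) v∉X
      ... | false = refl

      x-I : ∀ {v} → v ∈ I → x v ≈ q
      x-I v∈I = trans (+-cong (trans (*-congˡ (χ-∈ v∈I)) (*-identityʳ q))
                              (trans (*-congˡ (χ-∉ (disjoint v∈I))) (zeroʳ p)))
                      (+-identityʳ q)

      x-S : ∀ {v} → v ∈ S → x v ≈ p
      x-S v∈S = trans (+-cong (trans (*-congˡ (χ-∉ λ v∈I → disjoint v∈I v∈S)) (zeroʳ q))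
                              (trans (*-congˡ (χ-∈ v∈S)) (*-identityʳ p)))
                      (+-identityˡ p)

      0≤χ : ∀ X v → 0# ≤ χ X v
      0≤χ X v = 0≤indicator (lookup X v)

      0≤x : ∀ v → 0# ≤ x v
      0≤x v = 0≤+ (*-nonNegative 0≤q (0≤χ I v)) (*-nonNegative 0≤p (0≤χ S v))

      x·x : dot x x ≈ q * q * fromℕ ∣ I ∣ + p * p * fromℕ ∣ S ∣
      x·x = begin
        dot x x
          ≈⟨ sum-cong-≋ {n} square ⟩
        ∑[ v < n ] (q * q * χ I v + p * p * χ S v)
          ≈⟨ trans (∑-distrib-+ {n} _ _)
               (+-cong (sym (*-distribˡ-sum {n} (q * q) _)) (sym (*-distribˡ-sum {n} (p * p) _))) ⟩
        q * q * ∑[ v < n ] χ I v + p * p * ∑[ v < n ] χ S v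
          ≈⟨ +-cong (*-congˡ (fromℕ-∣∣ I)) (*-congˡ (fromℕ-∣∣ S)) ⟨
        q * q * fromℕ ∣ I ∣ + p * p * fromℕ ∣ S ∣ ∎
        where
        open ≈-Reasoning
        square : ∀ v → x v * x v ≈ q * q * χ I v + p * p * χ S v
        square v with v ∈? I | v ∈? S
        ... | yes v∈I | _ = trans (*-cong (x-I v∈I) (x-I v∈I))
          (sym (trans (+-cong (trans (*-congˡ (χ-∈ v∈I)) (*-identityʳ _))
                              (trans (*-congˡ (χ-∉ (disjoint v∈I))) (zeroʳ _))) (+-identityʳ _)))
        ... | no v∉I | yes v∈S = trans (*-cong (x-S v∈S) (x-S v∈S))
          (sym (trans (+-cong (trans (*-congˡ (χ-∉ v∉I)) (zeroʳ _))
                              (trans (*-congˡ (χ-∈ v∈S)) (*-identityʳ _))) (+-identityˡ _)))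
        ... | no v∉I | no v∉S = trans
          (*-cong x≈0 x≈0)
          (trans (zeroʳ 0#) (sym (trans (+-cong (trans (*-congˡ (χ-∉ v∉I)) (zeroʳ _))
                              (trans (*-congˡ (χ-∉ v∉S)) (zeroʳ _))) (+-identityˡ _))))
          where
          x≈0 : x v ≈ 0#
          x≈0 = trans (+-cong (trans (*-congˡ (χ-∉ v∉I)) (zeroʳ _))
                              (trans (*-congˡ (χ-∉ v∉S)) (zeroʳ _))) (+-identityˡ _)

      module _ {a : Carrier} (0≤a : 0# ≤ a) where

        private
          -- These are the contributions of an ordered adjacent pair starting in `I` and of one
          -- ending in `I`.
          cᴵ cˢ : Carrier
          cᴵ = a * (q * q) + q * p
          cˢ = a * (p * p) + p * q

        -- An edge with one end in `I` has the other in `S`, and equality holds. Any other edge is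
        -- compared with 0, its contribution being nonnegative.
        entry : ∀ u v → A u v * (χ I u * cᴵ + χ I v * cˢ) ≤ A u v * (a * (x u * x u) + x u * x v)
        entry u v with adj u v in eq
        ... | false = ≤-reflexive (trans (zeroˡ _) (sym (zeroˡ _)))
        ... | true  = *-monoˡ-≤ 0≤1 (edge-entry (u ∈? I) (v ∈? I))
          where
          u~v : T (adj u v)
          u~v = Equivalence.from T-≡ eq
          edge-entry : Dec (u ∈ I) → Dec (v ∈ I) →
                       χ I u * cᴵ + χ I v * cˢ ≤ a * (x u * x u) + x u * x v
          edge-entry (yes u∈I) _ = ≤-reflexive (trans
            (+-cong (trans (*-congʳ (χ-∈ u∈I)) (*-identityˡ _))
                    (trans (*-congʳ (χ-∉ λ v∈I → disjoint v∈I v∈S)) (zeroˡ _)))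
            (trans (+-identityʳ _)
              (sym (+-cong (*-congˡ (*-cong (x-I u∈I) (x-I u∈I))) (*-cong (x-I u∈I) (x-S v∈S))))))
            where v∈S = I-neighbours u∈I u~v
          edge-entry (no u∉I) (yes v∈I) = ≤-reflexive (trans
            (+-cong (trans (*-congʳ (χ-∉ u∉I)) (zeroˡ _))
                    (trans (*-congʳ (χ-∈ v∈I)) (*-identityˡ _)))
            (trans (+-identityˡ _)
              (sym (+-cong (*-congˡ (*-cong (x-S u∈S) (x-S u∈S))) (*-cong (x-S u∈S) (x-I v∈I))))))
            where u∈S = I-neighbours v∈I (~-sym G u~v)
          edge-entry (no u∉I) (no v∉I) = ≤-trans
            (≤-reflexive (trans (+-cong (trans (*-congʳ (χ-∉ u∉I)) (zeroˡ _))
                                        (trans (*-congʳ (χ-∉ v∉I)) (zeroˡ _)))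
                                (+-identityˡ 0#)))
            (0≤+ (*-nonNegative 0≤a (0≤x² (x u))) (*-nonNegative (0≤x u) (0≤x v)))

        -- The sum `e` counts the edges at `I`, at least δ for each vertex of `I`. Each appears once
        -- in either direction and so contributes `cᴵ` and `cˢ`.
        form-lower-bound : ∀ {δ} → (∀ v → δ ℕ.≤ degree G v) →
          (cᴵ + cˢ) * (fromℕ δ * fromℕ ∣ I ∣) ≤ form (aD+A G a) x
        form-lower-bound {δ} δ≤degree = begin
          (cᴵ + cˢ) * (fromℕ δ * fromℕ ∣ I ∣)
            ≤⟨ *-monoˡ-≤ 0≤c δ∣I∣≤e ⟩
          (cᴵ + cˢ) * e
            ≈⟨ distribʳ e cᴵ cˢ ⟩
          cᴵ * e + cˢ * e
            ≈⟨ +-congˡ (*-congˡ transposed) ⟩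
          cᴵ * e + cˢ * ∑[ u < n ] ∑[ v < n ] (A u v * χ I v)
            ≈⟨ +-cong (scale cᴵ) (scale cˢ) ⟩
          ∑[ u < n ] ∑[ v < n ] (cᴵ * (A u v * χ I u)) + ∑[ u < n ] ∑[ v < n ] (cˢ * (A u v * χ I v))
            ≈⟨ trans (sum-cong-≋ {n} λ u → ∑-distrib-+ {n} _ _) (∑-distrib-+ {n} _ _) ⟨
          ∑[ u < n ] ∑[ v < n ] (cᴵ * (A u v * χ I u) + cˢ * (A u v * χ I v))
            ≈⟨ sum-cong-≋ {n} (λ u → sum-cong-≋ {n} λ v → collect cᴵ cˢ (A u v) (χ I u) (χ I v)) ⟩
          ∑[ u < n ] ∑[ v < n ] (A u v * (χ I u * cᴵ + χ I v * cˢ))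
            ≤⟨ sum-mono-≤ (λ u → sum-mono-≤ (entry u)) ⟩
          ∑[ u < n ] ∑[ v < n ] (A u v * (a * (x u * x u) + x u * x v))
            ≈⟨ form-aD+A a x ⟨
          form (aD+A G a) x ∎
          where
          open ≤-Reasoning
          e = ∑[ u < n ] ∑[ v < n ] (A u v * χ I u)
          0≤c : 0# ≤ cᴵ + cˢ
          0≤c = 0≤+ (0≤+ (*-nonNegative 0≤a (0≤x² q)) (*-nonNegative 0≤q 0≤p))
                    (0≤+ (*-nonNegative 0≤a (0≤x² p)) (*-nonNegative 0≤p 0≤q))
          transposed : e ≈ ∑[ u < n ] ∑[ v < n ] (A u v * χ I v)
          transposed = trans (∑-comm {n} {n} _)
            (sum-cong-≋ {n} λ u → sum-cong-≋ {n} λ v → *-congʳ (A-sym v u))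
          scale : ∀ c {t : Matrix n} → c * ∑[ u < n ] ∑[ v < n ] t u v ≈ ∑[ u < n ] ∑[ v < n ] (c * t u v)
          scale c = trans (*-distribˡ-sum {n} c _) (sum-cong-≋ {n} λ u → *-distribˡ-sum {n} c _)
          collect : ∀ c d A y z → c * (A * y) + d * (A * z) ≈ A * (y * c + z * d)
          collect = solve 5 (λ c d A y z → c :* (A :* y) :+ d :* (A :* z)
                                        := A :* (y :* c :+ z :* d)) refl
          δ∣I∣≤e : fromℕ δ * fromℕ ∣ I ∣ ≤ e
          δ∣I∣≤e = begin
            fromℕ δ * fromℕ ∣ I ∣
              ≈⟨ trans (*-congˡ (fromℕ-∣∣ I)) (*-distribˡ-sum {n} (fromℕ δ) _) ⟩
            ∑[ u < n ] (fromℕ δ * χ I u)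
              ≤⟨ sum-mono-≤ (λ u → *-monoʳ-≤ (0≤χ I u) (fromℕ-mono-≤ (δ≤degree u))) ⟩
            ∑[ u < n ] (fromℕ (degree G u) * χ I u)
              ≈⟨ sum-cong-≋ {n} (λ u → trans (*-congʳ (degree≈∑ u)) (*-distribʳ-sum {n} (χ I u) _)) ⟩
            e ∎

  -- The three ranges of a

  φ-zero : ∀ {a} n δ k → a ≈ 0# → φ a n δ k ≈ δ * √ (1# + (2# * k) / (n - k))
  φ-zero {a} n δ k a≈0 with a ≈? 0# | a ≤? 1#
  ... | yes _   | _ = refl
  ... | no  a≉0 | _ = contradiction a≈0 a≉0

  φ-≤1 : ∀ {a} n δ k → ¬ a ≈ 0# → a ≤ 1# → φ a n δ k ≈ (2# * a * δ * n) / (n - k)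
  φ-≤1 {a} n δ k a≉0 a≤1 with a ≈? 0# | a ≤? 1#
  ... | yes a≈0 | _       = contradiction a≈0 a≉0
  ... | no  _   | yes _   = refl
  ... | no  _   | no  a≰1 = contradiction a≤1 a≰1

  φ->1 : ∀ {a} n δ k → ¬ a ≈ 0# → ¬ a ≤ 1# → φ a n δ k ≈ (a * δ * (n + k)) / (n - k)
  φ->1 {a} n δ k a≉0 a≰1 with a ≈? 0# | a ≤? 1#
  ... | yes a≈0 | _       = contradiction a≈0 a≉0
  ... | no  _   | yes a≤1 = contradiction a≤1 a≰1
  ... | no  _   | no  _   = refl

  -- Test vectors supported on a barrier: √ρ on S and 1 on I if a = 0, ρ on S
  -- and 1 on I if 0 < a ≤ 1, the indicator of S if a > 1, with
  -- ρ = (n + 1) / (n - 1) ≤ ∣I∣ / ∣S∣.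
  module BarrierBound {k : ℕ} (G : Graph (2 ℕ.+ k)) (connected : Connected G)
    (barrier : Barrier G) {δ : ℕ} (δ≤degree : ∀ v → δ ℕ.≤ degree G v)
    {a : Carrier} (0≤a : 0# ≤ a) where
    open Barrier barrier

    private
      N D ρ s t d : Carrier
      N = fromℕ (2 ℕ.+ k)
      D = N - 1#
      ρ = (N + 1#) / D
      s = fromℕ ∣ S ∣
      t = fromℕ ∣ I ∣
      d = fromℕ δ

    I-nonempty : Nonempty I
    I-nonempty = 0<∣p∣⇒Nonempty I (ℕ.≤-<-trans z≤n ∣S∣<∣I∣)

    -- A walk to a different vertex cannot be empty, and its first step gives the neighbour. With at
    -- least two vertices, one of `zero` and `suc zero` is always a possible target.
    has-neighbour : ∀ {m} (H : Graph (2 ℕ.+ m)) → Connected H → ∀ u → ∃[ v ] T (Graph.adj H u v)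
    has-neighbour H connected zero with connected zero (suc zero)
    ... | _◅_ {j = v} u~v _ = v , u~v
    has-neighbour H connected (suc u) with connected (suc u) zero
    ... | _◅_ {j = v} u~v _ = v , u~v

    -- Connectedness enters here: the indicator of `S` has to be a nonzero vector.
    S-nonempty : Nonempty S
    S-nonempty with u , u∈I ← I-nonempty with v , u~v ← has-neighbour G connected u =
      v , I-neighbours u∈I u~v

    D+1≈N : D + 1# ≈ N
    D+1≈N = -‿+-cancel 1# N

    D≈ : D ≈ fromℕ (ℕ.suc k)
    D≈ = trans (+-congʳ (+-comm 1# _)) (+-‿-cancel 1# (fromℕ (ℕ.suc k)))

    1≤D : 1# ≤ D
    1≤D = ≤-resp refl (sym D≈) (1≤fromℕ-suc k)

    0≤D : 0# ≤ D
    0≤D = ≤-trans 0≤1 1≤D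

    D≉0 : ¬ D ≈ 0#
    D≉0 = 1≤x⇒x≉0 1≤D

    Dρ≈N+1 : D * ρ ≈ N + 1#
    Dρ≈N+1 = *-/-cancel (N + 1#) D≉0

    0≤ρ : 0# ≤ ρ
    0≤ρ = *-nonNegative (0≤+ (0≤fromℕ (2 ℕ.+ k)) 0≤1) (0≤x⁻¹ 0≤D D≉0)

    -- The local `k` is n - 1. From s < t and s + t ≤ n follows 2s ≤ n - 1, hence (n + 1) s = 2s +
    -- (n - 1) s ≤ (n - 1)(s + 1) ≤ (n - 1) t.
    [n+1]s≤[n-1]t : ∀ {k s t} → s ℕ.< t → t ℕ.+ s ℕ.≤ ℕ.suc k → (2 ℕ.+ k) ℕ.* s ℕ.≤ k ℕ.* t
    [n+1]s≤[n-1]t {k} {s} {ℕ.suc t} (s≤s s≤t) (s≤s t+s≤k) = begin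
      s ℕ.+ (s ℕ.+ k ℕ.* s)    ≡⟨ ℕ.+-assoc s s _ ⟨
      s ℕ.+ s ℕ.+ k ℕ.* s      ≤⟨ ℕ.+-monoˡ-≤ _ (ℕ.≤-trans (ℕ.+-monoˡ-≤ s s≤t) t+s≤k) ⟩
      k ℕ.+ k ℕ.* s            ≡⟨ ℕ.*-suc k s ⟨
      k ℕ.* ℕ.suc s            ≤⟨ ℕ.*-monoʳ-≤ k (s≤s s≤t) ⟩
      k ℕ.* ℕ.suc t            ∎
      where
      open ℕ.≤-Reasoning

    ρs≤t : ρ * s ≤ t
    ρs≤t = *-cancelˡ-≤ 0≤D D≉0 (begin
      D * (ρ * s)
        ≈⟨ trans (sym (*-assoc D ρ s)) (*-congʳ (trans Dρ≈N+1 (+-comm N 1#))) ⟩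
      fromℕ (3 ℕ.+ k) * s
        ≈⟨ ×1-homo-* (3 ℕ.+ k) ∣ S ∣ ⟨
      fromℕ ((3 ℕ.+ k) ℕ.* ∣ S ∣)
        ≤⟨ fromℕ-mono-≤ ([n+1]s≤[n-1]t ∣S∣<∣I∣ ∣I∣+∣S∣≤n) ⟩
      fromℕ (ℕ.suc k ℕ.* ∣ I ∣)
        ≈⟨ ×1-homo-* (ℕ.suc k) ∣ I ∣ ⟩
      fromℕ (ℕ.suc k) * t
        ≈⟨ *-congʳ D≈ ⟨
      D * t ∎)
      where
      open ≤-Reasoning

    1+2/D≈ρ : 1# + (2# * 1#) / D ≈ ρ
    1+2/D≈ρ = begin
      1# + (2# * 1#) / D
        ≈⟨ +-congʳ (*-inverseʳ D D≉0) ⟨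
      D * D ⁻¹ + (2# * 1#) * D ⁻¹
        ≈⟨ regroup D (D ⁻¹) ⟩
      (D + 1# + 1#) * D ⁻¹
        ≈⟨ *-congʳ (+-congʳ D+1≈N) ⟩
      (N + 1#) / D ∎
      where
      open ≈-Reasoning
      regroup : ∀ D r → D * r + ((1# + (1# + 0#)) * 1#) * r ≈ (D + 1# + 1#) * r
      regroup = solve 2 (λ D r →
        D :* r :+ ((con 1 :+ (con 1 :+ con 0)) :* con 1) :* r := (D :+ con 1 :+ con 1) :* r) refl

    module _ {p q : Carrier} (0≤p : 0# ≤ p) (0≤q : 0# ≤ q) where
      open TestVector G barrier 0≤p 0≤q

      test-bound : ∀ {c} → ¬ (∀ v → x v ≈ 0#) →
        c * (q * q * t + p * p * s) ≤ ((a * (q * q) + q * p) + (a * (p * p) + p * q)) * (d * t) →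
        RayleighBound (aD+A G a) c
      test-bound x≉0 c-bound = x , x≉0 ,
        ≤-trans (≤-resp (*-congˡ (sym x·x)) refl c-bound) (form-lower-bound 0≤a δ≤degree)

    I-supported : ∀ {p} (0≤p : 0# ≤ p) → ¬ (∀ v → TestVector.x G barrier 0≤p 0≤1 v ≈ 0#)
    I-supported 0≤p x≈0 with v , v∈I ← I-nonempty =
      0≉1 (sym (trans (sym (TestVector.x-I G barrier 0≤p 0≤1 v∈I)) (x≈0 v)))

    S-supported : ∀ {q} (0≤q : 0# ≤ q) → ¬ (∀ v → TestVector.x G barrier 0≤1 0≤q v ≈ 0#)
    S-supported 0≤q x≈0 with v , v∈S ← S-nonempty =
      0≉1 (sym (trans (sym (TestVector.x-S G barrier 0≤1 0≤q v∈S)) (x≈0 v)))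

    0≤d : 0# ≤ d
    0≤d = 0≤fromℕ δ
    0≤t : 0# ≤ t
    0≤t = 0≤fromℕ ∣ I ∣

    -- The squared norm t + ρ s is at most 2t, while the form is at least 2 √ρ δ t.
    bound-zero : a ≈ 0# → RayleighBound (aD+A G a) (φ a N d 1#)
    bound-zero a≈0 = test-bound 0≤r 0≤1 (I-supported 0≤r) (begin
      φ a N d 1# * (1# * 1# * t + r * r * s)
        ≈⟨ *-cong (φ-zero N d 1# a≈0) (+-congˡ (*-congʳ r²≈ρ)) ⟩
      d * r * (1# * 1# * t + ρ * s)
        ≤⟨ *-monoˡ-≤ (*-nonNegative 0≤d 0≤r) (+-monoʳ-≤ _ ρs≤t) ⟩
      d * r * (1# * 1# * t + t)
        ≈⟨ regroup d r t ⟩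
      ((0# * (1# * 1#) + 1# * r) + (0# * (r * r) + r * 1#)) * (d * t)
        ≈⟨ *-congʳ (+-cong (+-congʳ (*-congʳ a≈0)) (+-congʳ (*-congʳ a≈0))) ⟨
      ((a * (1# * 1#) + 1# * r) + (a * (r * r) + r * 1#)) * (d * t) ∎)
      where
      open ≤-Reasoning
      0≤1+2/D : 0# ≤ 1# + (2# * 1#) / D
      0≤1+2/D = ≤-resp refl (sym 1+2/D≈ρ) 0≤ρ
      r = √ (1# + (2# * 1#) / D)
      0≤r : 0# ≤ r
      0≤r = √-nonNegative 0≤1+2/D
      r²≈ρ : r * r ≈ ρ
      r²≈ρ = trans (√-square 0≤1+2/D) 1+2/D≈ρ
      regroup : ∀ d r t → d * r * (1# * 1# * t + t)
                        ≈ ((0# * (1# * 1#) + 1# * r) + (0# * (r * r) + r * 1#)) * (d * t)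
      regroup = solve 3 (λ d r t → d :* r :* (con 1 :* con 1 :* t :+ t)
        := ((con 0 :* (con 1 :* con 1) :+ con 1 :* r) :+ (con 0 :* (r :* r) :+ r :* con 1)) :* (d :* t)) refl

    -- The squared norm t + ρ² s is at most (1 + ρ) t. Since a ≤ 1, the coefficient a (1 + ρ²) + 2ρ
    -- of δ t in the form is at least a (1 + ρ)².
    bound-≤1 : ¬ a ≈ 0# → a ≤ 1# → RayleighBound (aD+A G a) (φ a N d 1#)
    bound-≤1 a≉0 a≤1 = test-bound 0≤ρ 0≤1 (I-supported 0≤ρ) (begin
      φ a N d 1# * (1# * 1# * t + ρ * ρ * s)
        ≈⟨ *-cong φ≈ (+-congˡ (*-assoc ρ ρ s)) ⟩
      a * d * (1# + ρ) * (1# * 1# * t + ρ * (ρ * s))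
        ≤⟨ *-monoˡ-≤ (*-nonNegative (*-nonNegative 0≤a 0≤d) (0≤+ 0≤1 0≤ρ))
             (+-monoʳ-≤ _ (*-monoˡ-≤ 0≤ρ ρs≤t)) ⟩
      a * d * (1# + ρ) * (1# * 1# * t + ρ * t)
        ≈⟨ regroup a d ρ t ⟩
      (a * (1# + ρ * ρ) + a * (ρ + ρ)) * (d * t)
        ≤⟨ *-monoʳ-≤ (*-nonNegative 0≤d 0≤t)
             (+-monoʳ-≤ _ (≤-resp refl (*-identityˡ _) (*-monoʳ-≤ (0≤+ 0≤ρ 0≤ρ) a≤1))) ⟩
      (a * (1# + ρ * ρ) + (ρ + ρ)) * (d * t)
        ≈⟨ *-congʳ (expand a ρ) ⟩
      ((a * (1# * 1#) + 1# * ρ) + (a * (ρ * ρ) + ρ * 1#)) * (d * t) ∎)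
      where
      open ≤-Reasoning
      regroup : ∀ a d ρ t → a * d * (1# + ρ) * (1# * 1# * t + ρ * t)
                          ≈ (a * (1# + ρ * ρ) + a * (ρ + ρ)) * (d * t)
      regroup = solve 4 (λ a d ρ t → a :* d :* (con 1 :+ ρ) :* (con 1 :* con 1 :* t :+ ρ :* t)
        := (a :* (con 1 :+ ρ :* ρ) :+ a :* (ρ :+ ρ)) :* (d :* t)) refl
      expand : ∀ a ρ → a * (1# + ρ * ρ) + (ρ + ρ)
                     ≈ (a * (1# * 1#) + 1# * ρ) + (a * (ρ * ρ) + ρ * 1#)
      expand = solve 2 (λ a ρ → a :* (con 1 :+ ρ :* ρ) :+ (ρ :+ ρ)
        := (a :* (con 1 :* con 1) :+ con 1 :* ρ) :+ (a :* (ρ :* ρ) :+ ρ :* con 1)) refl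
      -- Splitting 2n as (n - 1) + (n + 1) turns 2n / (n - 1) into 1 + ρ.
      φ≈ : φ a N d 1# ≈ a * d * (1# + ρ)
      φ≈ = begin-equality
        φ a N d 1#
          ≈⟨ φ-≤1 N d 1# a≉0 a≤1 ⟩
        (2# * a * d * N) * D ⁻¹
          ≈⟨ double a d N (D ⁻¹) ⟩
        a * d * ((N + N) * D ⁻¹)
          ≈⟨ *-congˡ (*-congʳ (+-congʳ D+1≈N)) ⟨
        a * d * ((D + 1# + N) * D ⁻¹)
          ≈⟨ *-congˡ (split D N (D ⁻¹)) ⟩
        a * d * (D * D ⁻¹ + ρ)
          ≈⟨ *-congˡ (+-congʳ (*-inverseʳ D D≉0)) ⟩
        a * d * (1# + ρ) ∎
        where
        double : ∀ a d N r → ((1# + (1# + 0#)) * a * d * N) * r ≈ a * d * ((N + N) * r)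
        double = solve 4 (λ a d N r → ((con 1 :+ (con 1 :+ con 0)) :* a :* d :* N) :* r
                                   := a :* d :* ((N :+ N) :* r)) refl
        split : ∀ D N r → (D + 1# + N) * r ≈ D * r + (N + 1#) * r
        split = solve 3 (λ D N r → (D :+ con 1 :+ N) :* r := D :* r :+ (N :+ con 1) :* r) refl

    -- The squared norm is s, and the degrees on `S` alone give the form at least a δ t ≥ a δ ρ s.
    bound->1 : ¬ a ≈ 0# → ¬ a ≤ 1# → RayleighBound (aD+A G a) (φ a N d 1#)
    bound->1 a≉0 a≰1 = test-bound 0≤1 ≤-refl (S-supported ≤-refl) (begin
      φ a N d 1# * (0# * 0# * t + 1# * 1# * s)
        ≈⟨ *-congʳ (trans (φ->1 N d 1# a≉0 a≰1) (*-assoc (a * d) (N + 1#) (D ⁻¹))) ⟩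
      a * d * ρ * (0# * 0# * t + 1# * 1# * s)
        ≈⟨ collect (a * d) ρ t s ⟩
      a * d * (ρ * s)
        ≤⟨ *-monoˡ-≤ (*-nonNegative 0≤a 0≤d) ρs≤t ⟩
      a * d * t
        ≈⟨ regroup a d t ⟩
      ((a * (0# * 0#) + 0# * 1#) + (a * (1# * 1#) + 1# * 0#)) * (d * t) ∎)
      where
      open ≤-Reasoning
      collect : ∀ c ρ t s → c * ρ * (0# * 0# * t + 1# * 1# * s) ≈ c * (ρ * s)
      collect = solve 4 (λ c ρ t s → c :* ρ :* (con 0 :* con 0 :* t :+ con 1 :* con 1 :* s)
                                  := c :* (ρ :* s)) refl
      regroup : ∀ a d t → a * d * t
                        ≈ ((a * (0# * 0#) + 0# * 1#) + (a * (1# * 1#) + 1# * 0#)) * (d * t)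
      regroup = solve 3 (λ a d t → a :* d :* t
        := ((a :* (con 0 :* con 0) :+ con 0 :* con 1) :+ (a :* (con 1 :* con 1) :+ con 1 :* con 0))
             :* (d :* t)) refl

    φ-bound : RayleighBound (aD+A G a) (φ a N d 1#)
    φ-bound = by-size (a ≈? 0#) (a ≤? 1#)
      where
      by-size : Dec (a ≈ 0#) → Dec (a ≤ 1#) → RayleighBound (aD+A G a) (φ a N d 1#)
      by-size (yes a≈0) _         = bound-zero a≈0
      by-size (no a≉0)  (yes a≤1) = bound-≤1 a≉0 a≤1
      by-size (no a≉0)  (no a≰1)  = bound->1 a≉0 a≰1

corollary4p4 : ∀ {ℓ} (ℝ : CompleteOrderedField ℓ) →
    let open Real ℝ in
    (a : Carrier) → 0# ≤ a →
    (n : ℕ) → 2 ℕ.≤ n →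
    (G : Graph n) → Connected G →
    (δ : ℕ) → IsMinDegree G δ → fromℕ δ ≤ (fromℕ n - 1#) / 2# →
    (λ₁ : Carrier) → IsLargestEigenvalue (aD+A G a) λ₁ →
    λ₁ < φ a (fromℕ n) (fromℕ δ) 1# →
    HasFractionalPerfectMatching G
corollary4p4 ℝ a 0≤a (ℕ.suc (ℕ.suc k)) (s≤s (s≤s z≤n)) G connected δ (_ , δ≤degree) _ λ₁ λ₁-largest (λ₁≤φ , λ₁≉φ)
  with perfect-or-barrier ℝ G
... | inj₁ perfect = perfect
... | inj₂ barrier = contradiction (antisym λ₁≤φ φ≤λ₁) λ₁≉φ
  where
  open Real ℝ
  φ≤λ₁ : φ a (fromℕ (2 ℕ.+ k)) (fromℕ δ) 1# ≤ λ₁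
  φ≤λ₁ = rayleighBound≤largestEigenvalue ℝ (aD+A G a) (aD+A-sym ℝ G a) λ₁-largest
    (BarrierBound.φ-bound ℝ G connected barrier δ≤degree 0≤a)
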